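{- Let $\beta\in \mathrm{Sym}_n(\mathbb Q)$ be positive semi-definite of rank $n-1$ and let $\ell\subset V$ be a rational isotropic line. Then there is a finite number of rational $n$-dimensional subspaces $U_1,\dots,U_a$ of $\ell^\perp$ such that $$\{U_1,\dots,U_a\}=\{\mathrm{span}(X):X\in\Omega_{\beta,\ell}\cap(L^n+h)\}.$$
   Context: $V$ is a $\mathbb Q$-vector space of dimension $p+1$ with a non-degenerate symmetric bilinear form $(\,,)$ of signature $(p,1)$, having nonzero rational isotropic vectors; $L\subset V$ is a $\mathbb Z$-lattice of full rank with $L\subset L^{\#}$ (dual lattice); $1\le n\le p$ and $h\in(L^{\#})^n$. For $X=(x_1,\dots,x_n)\in V^n$, $(X,X)$ is the matrix $((x_i,x_j))$ and $R(X)$ is the radical of the subspace $\mathrm{span}(X)$, i.e. $\{u\in\mathrm{span}(X):(u,\mathrm{span}(X))=0\}$. Put $\Omega_{\beta,\ell}=\{X\in V^n:\frac12(X,X)=\beta,\ R(X)=\ell\}$; its elements have entries in $\ell^\perp$. -}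

module Defs where

open import Algebra.Bundles using (CommutativeRing)
open import Algebra.Module.Bundles using (LeftModule)
import Algebra.Module.Construct.TensorUnit as TensorUnit
open import Algebra.Module.Morphism.Structures using (module LeftModuleMorphisms)
import Algebra.Properties.CommutativeMonoid.Sum as Sum
open import Data.Fin.Base using (Fin; _↑ˡ_; _↑ʳ_)
open import Data.Integer.Base using (ℤ)
open import Data.Nat.Base using (ℕ)
import Data.Nat.Base as ℕ
open import Data.Product.Base using (_×_; _,_; proj₁; proj₂; ∃-syntax; Σ-syntax)
open import Data.Rational.Base using (ℚ; 0ℚ; ½; _+_; _*_; -_; _/_; _≤_; _<_)
open import Data.Rational.Properties
  using (+-*-commutativeRing; +-0-commutativeMonoid; +-assoc; +-comm; +-identity;
         +-inverse; *-assoc; *-identityˡ; *-zeroˡ; *-zeroʳ; *-distribˡ-+; *-distribʳ-+)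
open import Data.Vec.Functional using (Vector; transpose)
open import Level using (Level; 0ℓ; _⊔_; suc)
open import Relation.Binary.PropositionalEquality
  using (_≡_; _≢_; refl; sym; trans; cong; cong₂)
open import Relation.Unary using (Pred; U; _∈_; _⊆_; _≐_; _∩_)

ℚ-VectorSpace : (m ℓm : Level) → Set (suc (m ⊔ ℓm))
ℚ-VectorSpace = LeftModule (CommutativeRing.ring +-*-commutativeRing)

sumℚ : ∀ {n} → Vector ℚ n → ℚ
sumℚ = Sum.sum +-0-commutativeMonoid

ℚ^ : ℕ → ℚ-VectorSpace 0ℓ 0ℓ
ℚ^ n = record
  { Carrierᴹ = Vector ℚ n
  ; _≈ᴹ_ = λ x y → ∀ i → x i ≡ y i
  ; _+ᴹ_ = λ x y i → x i + y i
  ; _*ₗ_ = λ q x i → q * x i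
  ; 0ᴹ   = λ _ → 0ℚ
  ; -ᴹ_  = λ x i → - x i
  ; isLeftModule = record
    { isLeftSemimodule = record
      { +ᴹ-isCommutativeMonoid = record
        { isMonoid = record
          { isSemigroup = record
            { isMagma = record
              { isEquivalence = record
                { refl  = λ _ → refl
                ; sym   = λ e i → sym (e i)
                ; trans = λ e f i → trans (e i) (f i)
                }
              ; ∙-cong = λ e f i → cong₂ _+_ (e i) (f i)
              }
            ; assoc = λ x y z i → +-assoc (x i) (y i) (z i)
            }
          ; identity = (λ x i → proj₁ +-identity (x i))
                     , (λ x i → proj₂ +-identity (x i))
          }
        ; comm = λ x y i → +-comm (x i) (y i)
        }
      ; isPreleftSemimodule = record
        { *ₗ-cong      = λ e f i → cong₂ _*_ e (f i)
        ; *ₗ-zeroˡ     = λ x i → *-zeroˡ (x i)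
        ; *ₗ-distribʳ  = λ x q r i → *-distribʳ-+ (x i) q r
        ; *ₗ-identityˡ = λ x i → *-identityˡ (x i)
        ; *ₗ-assoc     = λ q r x i → *-assoc q r (x i)
        ; *ₗ-zeroʳ     = λ q i → *-zeroʳ q
        ; *ₗ-distribˡ  = λ q x y i → *-distribˡ-+ q (x i) (y i)
        }
      }
    ; -ᴹ‿cong    = λ e i → cong -_ (e i)
    ; -ᴹ‿inverse = (λ x i → proj₁ +-inverse (x i))
                 , (λ x i → proj₂ +-inverse (x i))
    }
  }

module VectorSpace {m ℓm} (V : ℚ-VectorSpace m ℓm) where
  open LeftModule V public

  sumᴹ : ∀ {n} → Vector Carrierᴹ n → Carrierᴹ
  sumᴹ = Sum.sum +ᴹ-commutativeMonoid

  infixl 6 _-ᴹ_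
  _-ᴹ_ : Carrierᴹ → Carrierᴹ → Carrierᴹ
  u -ᴹ v = u +ᴹ (-ᴹ v)

  record Subspace (a : Level) : Set (m ⊔ ℓm ⊔ suc a) where
    field
      ∣_∣     : Pred Carrierᴹ a
      ≈-resp  : ∀ {u v} → u ≈ᴹ v → u ∈ ∣_∣ → v ∈ ∣_∣
      0-mem   : 0ᴹ ∈ ∣_∣
      +-mem   : ∀ {u v} → u ∈ ∣_∣ → v ∈ ∣_∣ → (u +ᴹ v) ∈ ∣_∣
      *-mem   : ∀ q {v} → v ∈ ∣_∣ → (q *ₗ v) ∈ ∣_∣

  open Subspace public using (∣_∣)

  combination : ∀ {n} → Vector ℚ n → Vector Carrierᴹ n → Carrierᴹ
  combination c X = sumᴹ (λ i → c i *ₗ X i)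

  Span : ∀ {n} → Vector Carrierᴹ n → Pred Carrierᴹ ℓm
  Span X v = ∃[ c ] v ≈ᴹ combination c X

  ℤ-Span : ∀ {n} → Vector Carrierᴹ n → Pred Carrierᴹ ℓm
  ℤ-Span {n} X v = Σ[ c ∈ Vector ℤ n ] v ≈ᴹ combination (λ i → c i / 1) X

  LinearlyIndependent : ∀ {n} → Vector Carrierᴹ n → Set ℓm
  LinearlyIndependent X = ∀ c → combination c X ≈ᴹ 0ᴹ → ∀ i → c i ≡ 0ℚ

  IsBasis : ∀ {a d} → Pred Carrierᴹ a → Vector Carrierᴹ d → Set (m ⊔ ℓm ⊔ a)
  IsBasis W e = LinearlyIndependent e × W ≐ Span e

  HasDimension : ∀ {a} → Pred Carrierᴹ a → ℕ → Set (m ⊔ ℓm ⊔ a)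
  HasDimension W d = Σ[ e ∈ Vector Carrierᴹ d ] IsBasis W e

  IsFullLattice : ∀ {a} → Pred Carrierᴹ a → Set (m ⊔ ℓm ⊔ a)
  IsFullLattice L =
    ∃[ d ] Σ[ e ∈ Vector Carrierᴹ d ] IsBasis U e × L ≐ ℤ-Span e

  record IsSymmetricBilinear (B : Carrierᴹ → Carrierᴹ → ℚ) : Set (m ⊔ ℓm) where
    open LeftModuleMorphisms rawLeftModule
      (LeftModule.rawLeftModule
        (TensorUnit.leftModule {R = CommutativeRing.ring +-*-commutativeRing}))
      using (IsLeftModuleHomomorphism)
    field
      symmetric : ∀ u v → B u v ≡ B v u
      linear    : ∀ v → IsLeftModuleHomomorphism (λ u → B u v)

  module Form (B : Carrierᴹ → Carrierᴹ → ℚ) where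

    NonDegenerate : Set (m ⊔ ℓm)
    NonDegenerate = ∀ u → (∀ v → B u v ≡ 0ℚ) → u ≈ᴹ 0ᴹ

    HasSignature : ℕ → ℕ → Set (m ⊔ ℓm)
    HasSignature r s = Σ[ e ∈ Vector Carrierᴹ (r ℕ.+ s) ]
      IsBasis U e ×
      (∀ i j → i ≢ j → B (e i) (e j) ≡ 0ℚ) ×
      (∀ (i : Fin r) → 0ℚ < B (e (i ↑ˡ s)) (e (i ↑ˡ s))) ×
      (∀ (j : Fin s) → B (e (r ↑ʳ j)) (e (r ↑ʳ j)) < 0ℚ)

    IsIsotropic : Pred Carrierᴹ 0ℓ
    IsIsotropic v = B v v ≡ 0ℚ

    IsIsotropicLine : ∀ {a} → Subspace a → Set (m ⊔ ℓm ⊔ a)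
    IsIsotropicLine ℓ = HasDimension ∣ ℓ ∣ 1 × ∣ ℓ ∣ ⊆ IsIsotropic

    infix 9 _^⊥ _^#

    _^⊥ : ∀ {a} → Pred Carrierᴹ a → Pred Carrierᴹ (m ⊔ a)
    (W ^⊥) u = ∀ w → w ∈ W → B u w ≡ 0ℚ

    _^# : ∀ {a} → Pred Carrierᴹ a → Pred Carrierᴹ (m ⊔ a)
    (L ^#) u = ∀ x → x ∈ L → ∃[ z ] B u x ≡ z / 1

    R : ∀ {n} → Vector Carrierᴹ n → Pred Carrierᴹ (m ⊔ ℓm)
    R X = Span X ∩ (Span X ^⊥)

    Ω : ∀ {a n} → Vector (Vector ℚ n) n → Subspace a →
        Pred (Vector Carrierᴹ n) (m ⊔ ℓm ⊔ a)
    Ω β ℓ X = (∀ i j → ½ * B (X i) (X j) ≡ β i j) × R X ≐ ∣ ℓ ∣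

  -- The coset Lⁿ + h, with membership expressed as X - h ∈ Lⁿ.
  Coset : ∀ {a n} → Pred Carrierᴹ a → Vector Carrierᴹ n → Pred (Vector Carrierᴹ n) a
  Coset L h X = ∀ i → (X i -ᴹ h i) ∈ L

IsSymmetricMatrix : ∀ {n} → Vector (Vector ℚ n) n → Set
IsSymmetricMatrix β = ∀ i j → β i j ≡ β j i

IsPositiveSemidefinite : ∀ {n} → Vector (Vector ℚ n) n → Set
IsPositiveSemidefinite {n} β =
  ∀ (c : Vector ℚ n) → 0ℚ ≤ sumℚ (λ i → sumℚ (λ j → c i * β i j * c j))

HasRank : ∀ {n k} → Vector (Vector ℚ n) k → ℕ → Set
HasRank {k = k} β r = HasDimension (Span (transpose β)) r
  where open VectorSpace (ℚ^ k)

{-# OPTIONS --safe #-}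
-- Let u span ℓ, and split V along an orthogonal basis with one negative vector.  For v ⊥ u, subtracting
-- the multiple of u that kills the negative coordinate does not change (v,v), so (v,v) bounds all
-- coordinates of v modulo ℓ.  Scaling u into L, an entry of X ∈ Ω_{β,ℓ} ∩ (Lⁿ + h) can be translated by
-- an integral multiple of u to a vector with bounded integral lattice coordinates, and the multiples can
-- be chosen so that span(X), which contains u, does not change.  Hence finitely many integral matrices
-- represent all the spans.
-- As β has corank one, its kernel is spanned by a single k, and among the tuples X ⊥ u with ½(X,X) = β
-- those with R(X) = ℓ are recognised by Σ kᵢ xᵢ ≠ 0, so the finite search is effective.
module Submission where

open import Algebra.Bundles using (CommutativeRing)
open import Algebra.Module.Morphism.Structures using (module LeftModuleMorphisms)
import Algebra.Properties.CommutativeMonoid.Sum as CommutativeMonoidSum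
import Algebra.Properties.Semiring.Sum as SemiringSum
open import Data.Bool.Base using (if_then_else_)
open import Data.Fin.Base
  using (Fin; zero; suc; toℕ; fromℕ<; punchIn; punchOut; finToFun; funToFin; _↑ˡ_; _↑ʳ_; splitAt; join)
open import Data.Fin.Properties using (all?; any?; punchIn-punchOut; finToFun-funToFin;
  toℕ-fromℕ<; join-splitAt)
import Data.Fin.Properties as Fin
open import Data.Integer.Base using (ℤ; +_; -[1+_]; 0ℤ; 1ℤ; _⊖_)
import Data.Integer.Base as ℤ
import Data.Integer.DivMod as ℤ
import Data.Integer.Properties as ℤ
open import Data.List.Base using (allFin; filter; lookup)
open import Data.List.Membership.Propositional.Properties using (∈-allFin; ∈-filter⁺; ∈-filter⁻; ∈-lookup)
open import Data.List.Relation.Unary.Any using (index)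
open import Data.List.Relation.Unary.Any.Properties using (lookup-index)
open import Data.Nat.Base using (ℕ; zero; suc; z≤n; s≤s)
import Data.Nat.Base as ℕ
open import Data.Nat.Coprimality using (1-coprimeTo) renaming (sym to coprime-sym)
import Data.Nat.Properties as ℕ
open import Data.Product.Base using (_×_; _,_; proj₁; proj₂; ∃-syntax; Σ-syntax)
open import Data.Rational.Base hiding (∣_∣; _⊔_; NonZero)
import Data.Rational.Base as ℚ
open import Data.Rational.Properties
import Data.Rational.Unnormalised.Base as ℚᵘ
open import Data.Sum.Base using (_⊎_; inj₁; inj₂)
open import Data.Vec.Functional using (Vector; transpose)
open import Defs
open import Function.Base using (_∘_; case_of_; id)
open import Level using (Level; _⊔_)
open import Relation.Binary.PropositionalEquality
import Relation.Binary.Reasoning.Setoid as SetoidReasoning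
open import Relation.Nullary using (Dec; yes; no; contradiction; does)
open import Relation.Nullary.Decidable using (dec⇒maybe; ¬?; decidable-stable; map′; _×-dec_)
open import Relation.Unary using (Pred; Decidable; U; _∈_; _⊆_; _≐_)
open import Tactic.RingSolver using (solve-∀)
open import Tactic.RingSolver.Core.AlmostCommutativeRing using (AlmostCommutativeRing; fromCommutativeRing)

open SemiringSum (CommutativeRing.semiring +-*-commutativeRing)
  using (*-distribˡ-sum; sum-cong-≗; ∑-distrib-+; sum-replicate-zero)

ℚ-ring : AlmostCommutativeRing _ _
ℚ-ring = fromCommutativeRing +-*-commutativeRing (λ x → dec⇒maybe (0ℚ ≟ x))

inverse : ∀ {q} → q ≢ 0ℚ → ∃[ r ] r * q ≡ 1ℚ
inverse {q} q≢0 = 1/ q , *-inverseˡ q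
  where instance _ = ≢-nonZero q≢0

p*q≢0 : ∀ {p q} → p ≢ 0ℚ → q ≢ 0ℚ → p * q ≢ 0ℚ
p*q≢0 {p} {q} p≢0 q≢0 pq≡0 = q≢0 (begin
  q            ≡⟨ *-identityˡ q ⟨
  1ℚ * q       ≡⟨ cong (_* q) r*p≡1 ⟨
  r * p * q    ≡⟨ *-assoc r p q ⟩
  r * (p * q)  ≡⟨ cong (r *_) pq≡0 ⟩
  r * 0ℚ       ≡⟨ *-zeroʳ r ⟩
  0ℚ           ∎)
  where
  open ≡-Reasoning
  r = proj₁ (inverse p≢0)
  r*p≡1 = proj₂ (inverse p≢0)

0≤p*p : ∀ p → 0ℚ ≤ p * p
0≤p*p p with ≤-total 0ℚ p
... | inj₁ 0≤p = subst (_≤ p * p) (*-zeroʳ p) (*-monoˡ-≤-nonNeg p {{nonNegative 0≤p}} 0≤p)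
... | inj₂ p≤0 = subst (_≤ p * p) (*-zeroʳ p) (*-monoˡ-≤-nonPos p {{nonPositive p≤0}} p≤0)

∣p*p∣≡p*p : ∀ p → ℚ.∣ p ∣ * ℚ.∣ p ∣ ≡ p * p
∣p*p∣≡p*p p = trans (sym (∣p*q∣≡∣p∣*∣q∣ p p)) (0≤p⇒∣p∣≡p (0≤p*p p))

square-bound : ∀ a → 0ℚ < a → ∀ N → ∃[ C ] ∀ x → x * x * a ≤ N → ℚ.∣ x ∣ ≤ C
square-bound a 0<a N = 1ℚ + N * a⁻¹ , bound
  where
  a⁻¹ = (1/ a) {{>-nonZero 0<a}}
  open ≤-Reasoning
  instance
    a⁻¹-nonNeg : NonNegative a⁻¹
    a⁻¹-nonNeg = pos⇒nonNeg a⁻¹ {{1/pos⇒pos a {{positive 0<a}}}}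
  bound : ∀ x → x * x * a ≤ N → ℚ.∣ x ∣ ≤ 1ℚ + N * a⁻¹
  bound x xxa≤N = case ≤-total ℚ.∣ x ∣ 1ℚ of λ where
      (inj₁ ∣x∣≤1) → begin
        ℚ.∣ x ∣          ≤⟨ ∣x∣≤1 ⟩
        1ℚ             ≡⟨ +-identityʳ 1ℚ ⟨
        1ℚ + 0ℚ        ≤⟨ +-monoʳ-≤ 1ℚ (≤-trans (0≤p*p x) xx≤) ⟩
        1ℚ + N * a⁻¹   ∎
      (inj₂ 1≤∣x∣) → begin
        ℚ.∣ x ∣          ≡⟨ *-identityʳ ℚ.∣ x ∣ ⟨
        ℚ.∣ x ∣ * 1ℚ     ≤⟨ *-monoˡ-≤-nonNeg ℚ.∣ x ∣ {{∣-∣-nonNeg x}} 1≤∣x∣ ⟩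
        ℚ.∣ x ∣ * ℚ.∣ x ∣  ≡⟨ ∣p*p∣≡p*p x ⟩
        x * x          ≡⟨ +-identityˡ _ ⟨
        0ℚ + x * x     ≤⟨ +-mono-≤ (nonNegative⁻¹ 1ℚ) xx≤ ⟩
        1ℚ + N * a⁻¹   ∎
    where
    xx≤ : x * x ≤ N * a⁻¹
    xx≤ = begin
      x * x              ≡⟨ *-identityʳ (x * x) ⟨
      x * x * 1ℚ         ≡⟨ cong (x * x *_) (*-inverseʳ a {{>-nonZero 0<a}}) ⟨
      x * x * (a * a⁻¹)  ≡⟨ *-assoc (x * x) a a⁻¹ ⟨
      x * x * a * a⁻¹    ≤⟨ *-monoʳ-≤-nonNeg a⁻¹ xxa≤N ⟩
      N * a⁻¹            ∎

/1-mkℚ : ∀ z → z / 1 ≡ mkℚ z 0 (coprime-sym (1-coprimeTo ℤ.∣ z ∣))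
/1-mkℚ z = fromℚᵘ-toℚᵘ (mkℚ z 0 (coprime-sym (1-coprimeTo ℤ.∣ z ∣)))

/1-+ : ∀ a b → (a ℤ.+ b) / 1 ≡ a / 1 + b / 1
/1-+ a b = sym (trans (cong₂ _+_ (/1-mkℚ a) (/1-mkℚ b))
  (cong (_/ 1) (cong₂ ℤ._+_ (ℤ.*-identityʳ a) (ℤ.*-identityʳ b))))

/1-* : ∀ a b → (a ℤ.* b) / 1 ≡ (a / 1) * (b / 1)
/1-* a b = sym (cong₂ _*_ (/1-mkℚ a) (/1-mkℚ b))

/1-mono-≤ : ∀ {a b} → a ℤ.≤ b → a / 1 ≤ b / 1
/1-mono-≤ {a} {b} a≤b = subst₂ _≤_ (sym (/1-mkℚ a)) (sym (/1-mkℚ b))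
  (*≤* (ℤ.*-monoʳ-≤-nonNeg 1ℤ a≤b))

p*↧p≡↥p : ∀ p → p * (↧ p / 1) ≡ ↥ p / 1
p*↧p≡↥p p@record{} = trans (cong (p *_) (/1-mkℚ (↧ p)))
  (fromℚᵘ-cong {ℚᵘ.mkℚᵘ (↥ p ℤ.* ↧ p) _} {ℚᵘ.mkℚᵘ (↥ p) 0} (ℚᵘ.*≡* (trans (ℤ.*-identityʳ (↥ p ℤ.* ↧ p))
    (cong (λ d → ↥ p ℤ.* + d) (sym (ℕ.*-identityʳ (↧ₙ p)))))))

fractional-shift : ∀ q → ∃[ m ] ℚ.∣ q + m / 1 ∣ ≤ 1ℚ
fractional-shift q@record{} = m , *-cancelˡ-≤-pos D {{posD}} (begin
    D * ℚ.∣ q + m / 1 ∣          ≡⟨ cong (_* ℚ.∣ q + m / 1 ∣) (0≤p⇒∣p∣≡p 0≤D) ⟨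
    ℚ.∣ D ∣ * ℚ.∣ q + m / 1 ∣      ≡⟨ ∣p*q∣≡∣p∣*∣q∣ D (q + m / 1) ⟨
    ℚ.∣ D * (q + m / 1) ∣        ≡⟨ cong ℚ.∣_∣ remainder-eq ⟩
    ℚ.∣ + r / 1 ∣                ≡⟨ 0≤p⇒∣p∣≡p (/1-mono-≤ {0ℤ} {+ r} (ℤ.+≤+ z≤n)) ⟩
    + r / 1                    ≤⟨ /1-mono-≤ {+ r} {↧ q} (ℤ.+≤+ (ℕ.<⇒≤ (ℤ.n%d<d (↥ q) (↧ q)))) ⟩
    D                          ≡⟨ *-identityʳ D ⟨
    D * 1ℚ                     ∎)
  where
  open ≤-Reasoning
  t = ↥ q ℤ./ ↧ q
  m = ℤ.- t
  r = ↥ q ℤ.% ↧ q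
  D = ↧ q / 1
  posD : Positive D
  posD = subst Positive (sym (/1-mkℚ (↧ q))) _
  0≤D : 0ℚ ≤ D
  0≤D = /1-mono-≤ {0ℤ} {↧ q} (ℤ.+≤+ z≤n)
  remainder-eq : D * (q + m / 1) ≡ + r / 1
  remainder-eq = E.begin
    D * (q + m / 1)          E.≡⟨ *-distribˡ-+ D q (m / 1) ⟩
    D * q + D * (m / 1)      E.≡⟨ cong₂ _+_ (trans (*-comm D q) (p*↧p≡↥p q)) (sym (/1-* (↧ q) m)) ⟩
    ↥ q / 1 + (↧ q ℤ.* m) / 1  E.≡⟨ /1-+ (↥ q) (↧ q ℤ.* m) ⟨
    (↥ q ℤ.+ ↧ q ℤ.* m) / 1  E.≡⟨ cong (_/ 1) int ⟩
    + r / 1                  E.∎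
    where
    module E = ≡-Reasoning
    int : ↥ q ℤ.+ ↧ q ℤ.* m ≡ + r
    int = E.begin
      ↥ q ℤ.+ ↧ q ℤ.* m                    E.≡⟨ cong (λ x → x ℤ.+ ↧ q ℤ.* m) (ℤ.a≡a%n+[a/n]*n (↥ q) (↧ q)) ⟩
      + r ℤ.+ t ℤ.* ↧ q ℤ.+ ↧ q ℤ.* m      E.≡⟨ ℤ.+-assoc (+ r) (t ℤ.* ↧ q) (↧ q ℤ.* m) ⟩
      + r ℤ.+ (t ℤ.* ↧ q ℤ.+ ↧ q ℤ.* m)    E.≡⟨ cong (λ x → + r ℤ.+ (x ℤ.+ ↧ q ℤ.* m)) (ℤ.*-comm t (↧ q)) ⟩
      + r ℤ.+ (↧ q ℤ.* t ℤ.+ ↧ q ℤ.* m)    E.≡⟨ cong (ℤ._+_ (+ r)) (ℤ.*-distribˡ-+ (↧ q) t m) ⟨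
      + r ℤ.+ ↧ q ℤ.* (t ℤ.+ m)            E.≡⟨ cong (λ x → + r ℤ.+ ↧ q ℤ.* x) (ℤ.+-inverseʳ t) ⟩
      + r ℤ.+ ↧ q ℤ.* 0ℤ                   E.≡⟨ cong (ℤ._+_ (+ r)) (ℤ.*-zeroʳ (↧ q)) ⟩
      + r ℤ.+ 0ℤ                           E.≡⟨ ℤ.+-identityʳ (+ r) ⟩
      + r                                  E.∎

common-denominator : ∀ {d} (x : Vector ℚ d) →
  ∃[ D ] D / 1 ≢ 0ℚ × Σ[ z ∈ Vector ℤ d ] ∀ k → (D / 1) * x k ≡ z k / 1
common-denominator {zero}  x = 1ℤ , (λ ()) , (λ ()) , λ ()
common-denominator {suc d} x
  with D , D≢0 , z , Dx≡z ← common-denominator (x ∘ suc) =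
    D ℤ.* c
  , (λ eq → p*q≢0 D≢0 c≢0 (trans (sym (/1-* D c)) eq))
  , (λ { zero → D ℤ.* ↥ x zero ; (suc k) → z k ℤ.* c })
  , λ { zero    → begin
          (D ℤ.* c) / 1 * x zero          ≡⟨ cong (_* x zero) (/1-* D c) ⟩
          (D / 1) * (c / 1) * x zero      ≡⟨ *-assoc (D / 1) (c / 1) (x zero) ⟩
          (D / 1) * ((c / 1) * x zero)
            ≡⟨ cong (D / 1 *_) (trans (*-comm (c / 1) (x zero)) (p*↧p≡↥p (x zero))) ⟩
          (D / 1) * (↥ x zero / 1)        ≡⟨ /1-* D (↥ x zero) ⟨
          (D ℤ.* ↥ x zero) / 1            ∎
      ; (suc k) → begin
          (D ℤ.* c) / 1 * x (suc k)       ≡⟨ cong (_* x (suc k)) (/1-* D c) ⟩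
          (D / 1) * (c / 1) * x (suc k)   ≡⟨ swap (D / 1) (c / 1) (x (suc k)) ⟩
          (D / 1) * x (suc k) * (c / 1)   ≡⟨ cong (_* (c / 1)) (Dx≡z k) ⟩
          (z k / 1) * (c / 1)             ≡⟨ /1-* (z k) c ⟨
          (z k ℤ.* c) / 1                 ∎ }
  where
  open ≡-Reasoning
  c = ↧ x zero
  c≢0 : c / 1 ≢ 0ℚ
  c≢0 eq with () ← trans (sym (/1-mkℚ c)) eq
  swap : ∀ p q r → p * q * r ≡ p * r * q
  swap = solve-∀ ℚ-ring

integer-bound : ∀ q → ∃[ K ] ∀ z → ℚ.∣ z / 1 ∣ ≤ q → ℤ.∣ z ∣ ℕ.≤ K
integer-bound q@record{} = ℤ.∣ ↥ q ∣ , bound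
  where
  +≤⇒≤∣∣ : ∀ {a j} → + a ℤ.≤ j → a ℕ.≤ ℤ.∣ j ∣
  +≤⇒≤∣∣ (ℤ.+≤+ a≤j) = a≤j
  bound : ∀ z → ℚ.∣ z / 1 ∣ ≤ q → ℤ.∣ z ∣ ℕ.≤ ℤ.∣ ↥ q ∣
  bound z z≤q = +≤⇒≤∣∣ (begin
    + ℤ.∣ z ∣              ≤⟨ ℤ.+≤+ (ℕ.m≤m*n ℤ.∣ z ∣ (↧ₙ q)) ⟩
    + (ℤ.∣ z ∣ ℕ.* ↧ₙ q)   ≡⟨ ℤ.pos-* ℤ.∣ z ∣ (↧ₙ q) ⟩
    + ℤ.∣ z ∣ ℤ.* ↧ q      ≤⟨ drop-*≤* (subst (λ x → ℚ.∣ x ∣ ≤ q) (/1-mkℚ z) z≤q) ⟩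
    ↥ q ℤ.* 1ℤ             ≡⟨ ℤ.*-identityʳ (↥ q) ⟩
    ↥ q                    ∎)
    where open ℤ.≤-Reasoning

∣sum∣≤sum : ∀ {n} (t s : Vector ℚ n) → (∀ i → ℚ.∣ t i ∣ ≤ s i) → ℚ.∣ sumℚ t ∣ ≤ sumℚ s
∣sum∣≤sum {zero}  t s t≤s = ≤-refl
∣sum∣≤sum {suc n} t s t≤s = ≤-trans (∣p+q∣≤∣p∣+∣q∣ (t zero) (sumℚ (t ∘ suc)))
  (+-mono-≤ (t≤s zero) (∣sum∣≤sum (t ∘ suc) (s ∘ suc) (t≤s ∘ suc)))

0≤sum : ∀ {n} (t : Vector ℚ n) → (∀ i → 0ℚ ≤ t i) → 0ℚ ≤ sumℚ t
0≤sum {zero}  t 0≤t = ≤-refl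
0≤sum {suc n} t 0≤t = +-mono-≤ (0≤t zero) (0≤sum (t ∘ suc) (0≤t ∘ suc))

term≤sum : ∀ {n} (t : Vector ℚ n) → (∀ i → 0ℚ ≤ t i) → ∀ i → t i ≤ sumℚ t
term≤sum t 0≤t zero    = subst (_≤ sumℚ t) (+-identityʳ (t zero))
  (+-monoʳ-≤ (t zero) (0≤sum (t ∘ suc) (0≤t ∘ suc)))
term≤sum t 0≤t (suc i) = subst (_≤ sumℚ t) (+-identityˡ (t (suc i)))
  (+-mono-≤ (0≤t zero) (term≤sum (t ∘ suc) (0≤t ∘ suc) i))

sum-zero : ∀ {n} (t : Vector ℚ n) → (∀ i → t i ≡ 0ℚ) → sumℚ t ≡ 0ℚ
sum-zero {n} t t≡0 = trans (sum-cong-≗ t≡0) (sum-replicate-zero n)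

sum-single : ∀ {n} (t : Vector ℚ n) i → (∀ j → i ≢ j → t j ≡ 0ℚ) → sumℚ t ≡ t i
sum-single t zero    t≡0 = trans (cong (_+_ (t zero)) (sum-zero (t ∘ suc) (λ j → t≡0 (suc j) λ ())))
  (+-identityʳ (t zero))
sum-single t (suc i) t≡0 = trans (cong₂ _+_ (t≡0 zero λ ())
    (sum-single (t ∘ suc) i (λ j i≢j → t≡0 (suc j) (i≢j ∘ Fin.suc-injective))))
  (+-identityˡ (t (suc i)))

family-bound : ∀ {n} (t : Vector ℕ n) → ∃[ K ] ∀ i → t i ℕ.≤ K
family-bound {zero}  t = 0 , λ ()
family-bound {suc n} t with K , t≤K ← family-bound (t ∘ suc) =
  t zero ℕ.⊔ K , λ { zero → ℕ.m≤m⊔n (t zero) K ; (suc i) → ℕ.m≤n⇒m≤o⊔n (t zero) (t≤K i) }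

-- Gaussian elimination on the column of the first unknown.
underdetermined : ∀ r (A : Fin r → Vector ℚ (suc r)) →
  Σ[ c ∈ Vector ℚ (suc r) ] (∃[ j ] c j ≢ 0ℚ) × ∀ i → sumℚ (λ j → c j * A i j) ≡ 0ℚ
underdetermined zero    A = (λ _ → 1ℚ) , (zero , λ ()) , λ ()
underdetermined (suc r) A with any? (λ i → ¬? (A i zero ≟ 0ℚ))
... | no  no-pivot = (λ { zero → 1ℚ ; (suc _) → 0ℚ }) , (zero , λ ()) , λ i → begin
    1ℚ * A i zero + sumℚ (λ j → 0ℚ * A i (suc j))
      ≡⟨ cong₂ _+_ (trans (*-identityˡ _) (decidable-stable (A i zero ≟ 0ℚ) (λ ≢0 → no-pivot (i , ≢0))))
                   (sum-zero _ (λ j → *-zeroˡ (A i (suc j)))) ⟩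
    0ℚ + 0ℚ ≡⟨⟩
    0ℚ ∎
  where open ≡-Reasoning
... | yes (i₀ , pivot≢0)
  with a⁻¹ , a⁻¹a≡1 ← inverse pivot≢0
  with c , (j₀ , c≢0) , Ac≡0 ← underdetermined r
         (λ i j → A (punchIn i₀ i) (suc j) - A (punchIn i₀ i) zero * a⁻¹ * A i₀ (suc j)) =
    c′ , (suc j₀ , c≢0) , λ i → solves i (i₀ Fin.≟ i)
  where
  open ≡-Reasoning
  rest : Fin (suc r) → ℚ
  rest i = sumℚ (λ j → c j * A i (suc j))
  c′ : Vector ℚ (suc (suc r))
  c′ zero    = - (a⁻¹ * rest i₀)
  c′ (suc j) = c j
  pivot-row : ∀ x a y → - (x * y) * a + y ≡ y * (1ℚ - x * a)
  pivot-row = solve-∀ ℚ-ring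
  entry : ∀ c a b x y → c * (a - b * x * y) ≡ c * a + - (b * x) * (c * y)
  entry = solve-∀ ℚ-ring
  regroup : ∀ x y b z → - (x * y) * b + z ≡ z + - (b * x) * y
  regroup = solve-∀ ℚ-ring
  solves : ∀ i → Dec (i₀ ≡ i) → sumℚ (λ j → c′ j * A i j) ≡ 0ℚ
  solves i (yes refl) = begin
    - (a⁻¹ * rest i₀) * A i₀ zero + rest i₀  ≡⟨ pivot-row a⁻¹ (A i₀ zero) (rest i₀) ⟩
    rest i₀ * (1ℚ - a⁻¹ * A i₀ zero)         ≡⟨ cong (λ x → rest i₀ * (1ℚ - x)) a⁻¹a≡1 ⟩
    rest i₀ * 0ℚ                             ≡⟨ *-zeroʳ (rest i₀) ⟩
    0ℚ                                       ∎
  solves i (no i₀≢i) = begin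
    - (a⁻¹ * rest i₀) * A i zero + rest i
      ≡⟨ regroup a⁻¹ (rest i₀) (A i zero) (rest i) ⟩
    rest i + - (A i zero * a⁻¹) * rest i₀
      ≡⟨ cong (_+_ (rest i)) (*-distribˡ-sum (- (A i zero * a⁻¹)) (λ j → c j * A i₀ (suc j))) ⟩
    rest i + sumℚ (λ j → - (A i zero * a⁻¹) * (c j * A i₀ (suc j)))
      ≡⟨ ∑-distrib-+ (λ j → c j * A i (suc j)) (λ j → - (A i zero * a⁻¹) * (c j * A i₀ (suc j))) ⟨
    sumℚ (λ j → c j * A i (suc j) + - (A i zero * a⁻¹) * (c j * A i₀ (suc j)))
      ≡⟨ sum-cong-≗ (λ j → entry (c j) (A i (suc j)) (A i zero) a⁻¹ (A i₀ (suc j))) ⟨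
    sumℚ (λ j → c j * (A i (suc j) - A i zero * a⁻¹ * A i₀ (suc j)))
      ≡⟨ cong (λ i → sumℚ (λ j → c j * (A i (suc j) - A i zero * a⁻¹ * A i₀ (suc j)))) (punchIn-punchOut i₀≢i) ⟨
    sumℚ (λ j → c j * (A (punchIn i₀ (punchOut i₀≢i)) (suc j)
                     - A (punchIn i₀ (punchOut i₀≢i)) zero * a⁻¹ * A i₀ (suc j)))
      ≡⟨ Ac≡0 (punchOut i₀≢i) ⟩
    0ℚ ∎

enumerate-satisfying : ∀ {p M} {P : Pred (Fin M) p} → Decidable P →
  ∃[ k ] Σ[ g ∈ (Fin k → Fin M) ] (∀ i → P (g i)) × (∀ j → P j → ∃[ i ] g i ≡ j)
enumerate-satisfying {M = M} P? =
    _ , lookup xs , (λ i → proj₂ (∈-filter⁻ P? {xs = allFin M} (∈-lookup i)))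
  , λ j Pj → let j∈ = ∈-filter⁺ P? (∈-allFin j) Pj in index j∈ , sym (lookup-index j∈)
  where xs = filter P? (allFin M)

bounded-matrices : ∀ n d K → ∃[ M ] Σ[ decode ∈ (Fin M → Fin n → Fin d → ℤ) ]
  ∀ (z : Fin n → Fin d → ℤ) → (∀ i k → ℤ.∣ z i k ∣ ℕ.≤ K) → ∃[ j ] ∀ i k → decode j i k ≡ z i k
bounded-matrices n d K = _ , decode , hits
  where
  N = suc (K ℕ.+ K)
  decode : Fin ((N ℕ.^ d) ℕ.^ n) → Fin n → Fin d → ℤ
  decode j i k = toℕ (finToFun {N} {d} (finToFun j i) k) ⊖ K
  hits : ∀ (z : Fin n → Fin d → ℤ) → (∀ i k → ℤ.∣ z i k ∣ ℕ.≤ K) → ∃[ j ] ∀ i k → decode j i k ≡ z i k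
  hits z z≤K = funToFin (λ i → funToFin (shifted i)) , λ i k → begin
      toℕ (finToFun {N} {d} (finToFun (funToFin (λ i → funToFin (shifted i))) i) k) ⊖ K
        ≡⟨ cong (λ x → toℕ (finToFun {N} {d} x k) ⊖ K) (finToFun-funToFin (λ i → funToFin (shifted i)) i) ⟩
      toℕ (finToFun {N} {d} (funToFin (shifted i)) k) ⊖ K
        ≡⟨ cong (λ x → toℕ x ⊖ K) (finToFun-funToFin (shifted i) k) ⟩
      toℕ (shifted i k) ⊖ K
        ≡⟨ cong (_⊖ K) (toℕ-fromℕ< (shift< (z i k) (z≤K i k))) ⟩
      ℤ.∣ z i k ℤ.+ + K ∣ ⊖ K
        ≡⟨ unshift (z i k) (z≤K i k) ⟩
      z i k ∎
    where
    open ≡-Reasoning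
    shift< : ∀ z → ℤ.∣ z ∣ ℕ.≤ K → ℤ.∣ z ℤ.+ + K ∣ ℕ.< N
    shift< z z≤K = s≤s (ℕ.≤-trans (ℤ.∣i+j∣≤∣i∣+∣j∣ z (+ K)) (ℕ.+-monoˡ-≤ K z≤K))
    shifted : Fin n → Fin d → Fin N
    shifted i k = fromℕ< (shift< (z i k) (z≤K i k))
    0≤z+K : ∀ z → ℤ.∣ z ∣ ℕ.≤ K → 0ℤ ℤ.≤ z ℤ.+ + K
    0≤z+K (+ a)    _   = ℤ.+≤+ z≤n
    0≤z+K -[1+ a ] a<K = subst (0ℤ ℤ.≤_) (sym (ℤ.⊖-≥ a<K)) (ℤ.+≤+ z≤n)
    unshift : ∀ z → ℤ.∣ z ∣ ℕ.≤ K → ℤ.∣ z ℤ.+ + K ∣ ⊖ K ≡ z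
    unshift z z≤K = begin
      ℤ.∣ z ℤ.+ + K ∣ ⊖ K           ≡⟨ ℤ.m-n≡m⊖n ℤ.∣ z ℤ.+ + K ∣ K ⟨
      + ℤ.∣ z ℤ.+ + K ∣ ℤ.- + K     ≡⟨ cong (ℤ._- + K) (ℤ.0≤i⇒+∣i∣≡i (0≤z+K z z≤K)) ⟩
      z ℤ.+ + K ℤ.- + K             ≡⟨ ℤ.+-assoc z (+ K) (ℤ.- + K) ⟩
      z ℤ.+ (+ K ℤ.- + K)           ≡⟨ cong (ℤ._+_ z) (ℤ.+-inverseʳ (+ K)) ⟩
      z ℤ.+ 0ℤ                      ≡⟨ ℤ.+-identityʳ z ⟩
      z                             ∎

module LinearAlgebra {m ℓm} (V : ℚ-VectorSpace m ℓm) where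
  open VectorSpace V
  open CommutativeMonoidSum +ᴹ-commutativeMonoid using ()
    renaming (sum-cong-≋ to sumᴹ-cong; ∑-distrib-+ to sumᴹ-distrib-+)
  open SetoidReasoning ≈ᴹ-setoid

  record IsLinear (φ : Carrierᴹ → ℚ) : Set (m ⊔ ℓm) where
    field
      φ-cong : ∀ {v w} → v ≈ᴹ w → φ v ≡ φ w
      φ-+    : ∀ v w → φ (v +ᴹ w) ≡ φ v + φ w
      φ-*    : ∀ q v → φ (q *ₗ v) ≡ q * φ v

    φ-0 : φ 0ᴹ ≡ 0ℚ
    φ-0 = trans (φ-cong (≈ᴹ-sym (*ₗ-zeroˡ 0ᴹ))) (trans (φ-* 0ℚ 0ᴹ) (*-zeroˡ (φ 0ᴹ)))

    φ-combination : ∀ {n} (c : Vector ℚ n) X → φ (combination c X) ≡ sumℚ (λ i → c i * φ (X i))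
    φ-combination {zero}  c X = φ-0
    φ-combination {suc n} c X = trans (φ-+ (c zero *ₗ X zero) (combination (c ∘ suc) (X ∘ suc)))
      (cong₂ _+_ (φ-* (c zero) (X zero)) (φ-combination (c ∘ suc) (X ∘ suc)))

    φ-shift : ∀ v q u → φ (v +ᴹ q *ₗ u) ≡ φ v + q * φ u
    φ-shift v q u = trans (φ-+ v (q *ₗ u)) (cong (_+_ (φ v)) (φ-* q u))

  open IsLinear public

  combination-cong : ∀ {n} {c c′ : Vector ℚ n} {X X′} → (∀ i → c i ≡ c′ i) → (∀ i → X i ≈ᴹ X′ i) →
    combination c X ≈ᴹ combination c′ X′
  combination-cong c≡c′ X≈X′ = sumᴹ-cong (λ i → *ₗ-cong (c≡c′ i) (X≈X′ i))

  combination-+ˡ : ∀ {n} (c c′ : Vector ℚ n) X →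
    combination (λ i → c i + c′ i) X ≈ᴹ combination c X +ᴹ combination c′ X
  combination-+ˡ c c′ X = ≈ᴹ-trans
    (sumᴹ-cong (λ i → *ₗ-distribʳ (X i) (c i) (c′ i)))
    (sumᴹ-distrib-+ (λ i → c i *ₗ X i) (λ i → c′ i *ₗ X i))

  combination-+ʳ : ∀ {n} (c : Vector ℚ n) X Y →
    combination c (λ i → X i +ᴹ Y i) ≈ᴹ combination c X +ᴹ combination c Y
  combination-+ʳ c X Y = ≈ᴹ-trans
    (sumᴹ-cong (λ i → *ₗ-distribˡ (c i) (X i) (Y i)))
    (sumᴹ-distrib-+ (λ i → c i *ₗ X i) (λ i → c i *ₗ Y i))

  combination-*ˡ : ∀ {n} q (c : Vector ℚ n) X →
    combination (λ i → q * c i) X ≈ᴹ q *ₗ combination c X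
  combination-*ˡ {zero}  q c X = ≈ᴹ-sym (*ₗ-zeroʳ q)
  combination-*ˡ {suc n} q c X = ≈ᴹ-trans
    (+ᴹ-cong (*ₗ-assoc q (c zero) (X zero)) (combination-*ˡ q (c ∘ suc) (X ∘ suc)))
    (≈ᴹ-sym (*ₗ-distribˡ q _ _))

  combination-zeroˡ : ∀ {n} (c : Vector ℚ n) X → (∀ i → c i ≡ 0ℚ) → combination c X ≈ᴹ 0ᴹ
  combination-zeroˡ {zero}  c X c≡0 = ≈ᴹ-refl
  combination-zeroˡ {suc n} c X c≡0 = begin
    c zero *ₗ X zero +ᴹ combination (c ∘ suc) (X ∘ suc)
      ≈⟨ +ᴹ-cong (*ₗ-cong (c≡0 zero) ≈ᴹ-refl) (combination-zeroˡ (c ∘ suc) (X ∘ suc) (c≡0 ∘ suc)) ⟩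
    0ℚ *ₗ X zero +ᴹ 0ᴹ  ≈⟨ +ᴹ-identityʳ _ ⟩
    0ℚ *ₗ X zero        ≈⟨ *ₗ-zeroˡ (X zero) ⟩
    0ᴹ                  ∎

  combination-multiples : ∀ {n} (c q : Vector ℚ n) u →
    combination c (λ i → q i *ₗ u) ≈ᴹ sumℚ (λ i → c i * q i) *ₗ u
  combination-multiples {zero}  c q u = ≈ᴹ-sym (*ₗ-zeroˡ u)
  combination-multiples {suc n} c q u = ≈ᴹ-trans
    (+ᴹ-cong (≈ᴹ-sym (*ₗ-assoc (c zero) (q zero) u)) (combination-multiples (c ∘ suc) (q ∘ suc) u))
    (≈ᴹ-sym (*ₗ-distribʳ u _ _))

  combination-combination : ∀ {r n} (y : Vector ℚ r) (N : Fin r → Vector ℚ n) X →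
    combination y (λ a → combination (N a) X) ≈ᴹ combination (λ j → sumℚ (λ a → y a * N a j)) X
  combination-combination {zero}  y N X = ≈ᴹ-sym (combination-zeroˡ _ X (λ _ → refl))
  combination-combination {suc r} y N X = ≈ᴹ-trans
    (+ᴹ-cong (≈ᴹ-sym (combination-*ˡ (y zero) (N zero) X)) (combination-combination (y ∘ suc) (N ∘ suc) X))
    (≈ᴹ-sym (combination-+ˡ (λ j → y zero * N zero j) _ X))

  δ : ∀ {n} → Fin n → Vector ℚ n
  δ zero    zero    = 1ℚ
  δ zero    (suc j) = 0ℚ
  δ (suc i) zero    = 0ℚ
  δ (suc i) (suc j) = δ i j

  combination-δ : ∀ {n} i (X : Vector Carrierᴹ n) → combination (δ i) X ≈ᴹ X i
  combination-δ zero    X = begin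
    1ℚ *ₗ X zero +ᴹ combination (λ _ → 0ℚ) (X ∘ suc)
      ≈⟨ +ᴹ-cong (*ₗ-identityˡ (X zero)) (combination-zeroˡ _ (X ∘ suc) (λ _ → refl)) ⟩
    X zero +ᴹ 0ᴹ  ≈⟨ +ᴹ-identityʳ _ ⟩
    X zero        ∎
  combination-δ (suc i) X = begin
    0ℚ *ₗ X zero +ᴹ combination (δ i) (X ∘ suc)
      ≈⟨ +ᴹ-cong (*ₗ-zeroˡ (X zero)) (combination-δ i (X ∘ suc)) ⟩
    0ᴹ +ᴹ X (suc i)  ≈⟨ +ᴹ-identityˡ _ ⟩
    X (suc i)        ∎

  ∈-Span : ∀ {n} (X : Vector Carrierᴹ n) i → X i ∈ Span X
  ∈-Span X i = δ i , ≈ᴹ-sym (combination-δ i X)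

  span : ∀ {n} → Vector Carrierᴹ n → Subspace ℓm
  span X = record
    { ∣_∣    = Span X
    ; ≈-resp = λ { u≈v (c , u≈) → c , ≈ᴹ-trans (≈ᴹ-sym u≈v) u≈ }
    ; 0-mem  = (λ _ → 0ℚ) , ≈ᴹ-sym (combination-zeroˡ _ X (λ _ → refl))
    ; +-mem  = λ { (c , u≈) (c′ , v≈) → (λ i → c i + c′ i) ,
                   ≈ᴹ-trans (+ᴹ-cong u≈ v≈) (≈ᴹ-sym (combination-+ˡ c c′ X)) }
    ; *-mem  = λ { q (c , v≈) → (λ i → q * c i) ,
                   ≈ᴹ-trans (*ₗ-cong refl v≈) (≈ᴹ-sym (combination-*ˡ q c X)) }
    }

  combination-∈ : ∀ {a n} (S : Subspace a) {X : Vector Carrierᴹ n} → (∀ i → X i ∈ ∣ S ∣) →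
    ∀ c → combination c X ∈ ∣ S ∣
  combination-∈ {n = zero}  S X∈ c = Subspace.0-mem S
  combination-∈ {n = suc n} S X∈ c =
    Subspace.+-mem S (Subspace.*-mem S (c zero) (X∈ zero)) (combination-∈ S (X∈ ∘ suc) (c ∘ suc))

  Span-⊆ : ∀ {a n} (S : Subspace a) {X : Vector Carrierᴹ n} → (∀ i → X i ∈ ∣ S ∣) → Span X ⊆ ∣ S ∣
  Span-⊆ S X∈ (c , v≈) = Subspace.≈-resp S (≈ᴹ-sym v≈) (combination-∈ S X∈ c)

  scale-inverse : ∀ r q v → r * q ≡ 1ℚ → v ≈ᴹ r *ₗ (q *ₗ v)
  scale-inverse r q v rq≡1 = begin
    v              ≈⟨ *ₗ-identityˡ v ⟨
    1ℚ *ₗ v        ≈⟨ *ₗ-cong rq≡1 ≈ᴹ-refl ⟨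
    (r * q) *ₗ v   ≈⟨ *ₗ-assoc r q v ⟩
    r *ₗ (q *ₗ v)  ∎

  scale-≉0 : ∀ {q v} → q ≢ 0ℚ → v ≉ᴹ 0ᴹ → q *ₗ v ≉ᴹ 0ᴹ
  scale-≉0 {q} {v} q≢0 v≉0 qv≈0 with r , rq≡1 ← inverse q≢0 = v≉0 (begin
    v              ≈⟨ scale-inverse r q v rq≡1 ⟩
    r *ₗ (q *ₗ v)  ≈⟨ *ₗ-cong refl qv≈0 ⟩
    r *ₗ 0ᴹ        ≈⟨ *ₗ-zeroʳ r ⟩
    0ᴹ             ∎)

  relation-of-corank-one : ∀ {r} (X : Vector Carrierᴹ (suc r)) → HasDimension (Span X) r →
    Σ[ k ∈ Vector ℚ (suc r) ] (∃[ j ] k j ≢ 0ℚ) × combination k X ≈ᴹ 0ᴹ ×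
      (∀ c → combination c X ≈ᴹ 0ᴹ → ∃[ t ] ∀ j → c j ≡ t * k j)
  relation-of-corank-one {r} X (f , f-indep , X⊆f , f⊆X)
    with k , k≢0 , Mk≡0 ← underdetermined r (λ a j → proj₁ (X⊆f (∈-Span X j)) a) =
      k , k≢0 , kX≈0 , unique k≢0
    where
    M : Fin (suc r) → Vector ℚ r
    M j = proj₁ (X⊆f (∈-Span X j))
    N : Fin r → Vector ℚ (suc r)
    N a = proj₁ (f⊆X (∈-Span f a))
    kX≈0 : combination k X ≈ᴹ 0ᴹ
    kX≈0 = begin
      combination k X
        ≈⟨ combination-cong {c = k} (λ _ → refl) (λ j → proj₂ (X⊆f (∈-Span X j))) ⟩
      combination k (λ j → combination (M j) f)    ≈⟨ combination-combination k M f ⟩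
      combination (λ a → sumℚ (λ j → k j * M j a)) f  ≈⟨ combination-zeroˡ _ f Mk≡0 ⟩
      0ᴹ                                           ∎
    unique : ∃[ j ] k j ≢ 0ℚ → ∀ c → combination c X ≈ᴹ 0ᴹ → ∃[ t ] ∀ j → c j ≡ t * k j
    unique (j₀ , kj₀≢0) c cX≈0 = dependent (underdetermined (suc r) system)
      where
      -- Unknowns: the coefficients s, t of c, k and y of the vectors N a.
      system : Fin (suc r) → Vector ℚ (suc (suc r))
      system j zero          = c j
      system j (suc zero)    = k j
      system j (suc (suc a)) = N a j
      dependent : Σ[ x ∈ Vector ℚ (suc (suc r)) ] (∃[ j ] x j ≢ 0ℚ) ×
        (∀ i → sumℚ (λ j → x j * system i j) ≡ 0ℚ) → ∃[ t ] ∀ j → c j ≡ t * k j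
      dependent (x , x≢0 , eqs) = case x zero ≟ 0ℚ of λ where
          (no s≢0)  → let s⁻¹ , s⁻¹s≡1 = inverse s≢0 in
            - (s⁻¹ * t) , λ j → solve-for (c j) (k j) s⁻¹ s⁻¹s≡1 (sc+tk≡0 j)
          (yes s≡0) → contradiction (all-zero s≡0) (proj₂ x≢0)
        where
        s = x zero
        t = x (suc zero)
        y : Vector ℚ r
        y a = x (suc (suc a))
        yf≈0 : combination y f ≈ᴹ 0ᴹ
        yf≈0 = begin
          combination y f
            ≈⟨ combination-cong {c = y} (λ _ → refl) (λ a → proj₂ (f⊆X (∈-Span f a))) ⟩
          combination y (λ a → combination (N a) X)
            ≈⟨ combination-combination y N X ⟩
          combination (λ j → sumℚ (λ a → y a * N a j)) X
            ≈⟨ combination-cong {X = X} (λ j → move s (c j) t (k j) _ (eqs j)) (λ _ → ≈ᴹ-refl) ⟩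
          combination (λ j → - s * c j + - t * k j) X
            ≈⟨ combination-+ˡ (λ j → - s * c j) (λ j → - t * k j) X ⟩
          combination (λ j → - s * c j) X +ᴹ combination (λ j → - t * k j) X
            ≈⟨ +ᴹ-cong (combination-*ˡ (- s) c X) (combination-*ˡ (- t) k X) ⟩
          - s *ₗ combination c X +ᴹ - t *ₗ combination k X
            ≈⟨ +ᴹ-cong (*ₗ-cong refl cX≈0) (*ₗ-cong refl kX≈0) ⟩
          - s *ₗ 0ᴹ +ᴹ - t *ₗ 0ᴹ
            ≈⟨ +ᴹ-cong (*ₗ-zeroʳ (- s)) (*ₗ-zeroʳ (- t)) ⟩
          0ᴹ +ᴹ 0ᴹ  ≈⟨ +ᴹ-identityˡ 0ᴹ ⟩
          0ᴹ        ∎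
          where
          ring₁ : ∀ s c t k z → z ≡ (s * c + (t * k + z)) + (- s * c + - t * k)
          ring₁ = solve-∀ ℚ-ring
          move : ∀ s c t k z → s * c + (t * k + z) ≡ 0ℚ → z ≡ - s * c + - t * k
          move s c t k z eq = trans (ring₁ s c t k z) (trans (cong (_+ (- s * c + - t * k)) eq) (+-identityˡ _))
        y≡0 : ∀ a → y a ≡ 0ℚ
        y≡0 = f-indep y yf≈0
        sc+tk≡0 : ∀ j → s * c j + t * k j ≡ 0ℚ
        sc+tk≡0 j = trans (cong (_+_ (s * c j)) (sym (trans
            (cong (_+_ (t * k j)) (sum-zero (λ a → y a * N a j) (λ a → trans (cong (_* N a j) (y≡0 a)) (*-zeroˡ (N a j)))))
            (+-identityʳ (t * k j))))) (eqs j)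
        solve-for : ∀ c k s⁻¹ → s⁻¹ * s ≡ 1ℚ → s * c + t * k ≡ 0ℚ → c ≡ - (s⁻¹ * t) * k
        solve-for c k s⁻¹ s⁻¹s≡1 eq = ≡.begin
            c                                          ≡.≡⟨ *-identityˡ c ⟨
            1ℚ * c                                     ≡.≡⟨ cong (_* c) s⁻¹s≡1 ⟨
            s⁻¹ * s * c                                ≡.≡⟨ ring₂ s⁻¹ s c t k ⟩
            s⁻¹ * (s * c + t * k) + - (s⁻¹ * t) * k    ≡.≡⟨ cong (λ z → s⁻¹ * z + - (s⁻¹ * t) * k) eq ⟩
            s⁻¹ * 0ℚ + - (s⁻¹ * t) * k                 ≡.≡⟨ cong (_+ - (s⁻¹ * t) * k) (*-zeroʳ s⁻¹) ⟩
            0ℚ + - (s⁻¹ * t) * k                       ≡.≡⟨ +-identityˡ _ ⟩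
            - (s⁻¹ * t) * k                            ≡.∎
          where
          module ≡ = ≡-Reasoning
          ring₂ : ∀ r s c t k → r * s * c ≡ r * (s * c + t * k) + - (r * t) * k
          ring₂ = solve-∀ ℚ-ring
        t≡0 : s ≡ 0ℚ → t ≡ 0ℚ
        t≡0 s≡0 = decidable-stable (t ≟ 0ℚ) λ t≢0 → p*q≢0 t≢0 kj₀≢0
          (trans (sym (trans (cong (λ s → s * c j₀ + t * k j₀) s≡0)
                             (trans (cong (_+ t * k j₀) (*-zeroˡ (c j₀))) (+-identityˡ _))))
                 (sc+tk≡0 j₀))
        all-zero : s ≡ 0ℚ → x (proj₁ x≢0) ≡ 0ℚ
        all-zero s≡0 with proj₁ x≢0
        ... | zero        = s≡0
        ... | suc zero    = t≡0 s≡0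
        ... | suc (suc a) = y≡0 a

  module Coordinates {d : ℕ} {e : Vector Carrierᴹ d} (e-basis : IsBasis U e) where

    coord : Fin d → Carrierᴹ → ℚ
    coord k v = proj₁ (proj₁ (proj₂ e-basis) {v} _) k

    expansion : ∀ v → v ≈ᴹ combination (λ k → coord k v) e
    expansion v = proj₂ (proj₁ (proj₂ e-basis) {v} _)

    coord-unique : ∀ {v} c → v ≈ᴹ combination c e → ∀ k → coord k v ≡ c k
    coord-unique {v} c v≈ k = trans (ring (coord k v) (c k))
        (trans (cong (_+ c k) (proj₁ e-basis (λ k → coord k v + - 1ℚ * c k) difference k)) (+-identityˡ (c k)))
      where
      ring : ∀ a b → a ≡ (a + - 1ℚ * b) + b
      ring = solve-∀ ℚ-ring
      difference : combination (λ k → coord k v + - 1ℚ * c k) e ≈ᴹ 0ᴹ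
      difference = begin
        combination (λ k → coord k v + - 1ℚ * c k) e
          ≈⟨ combination-+ˡ (λ k → coord k v) (λ k → - 1ℚ * c k) e ⟩
        combination (λ k → coord k v) e +ᴹ combination (λ k → - 1ℚ * c k) e
          ≈⟨ +ᴹ-cong (expansion v) (≈ᴹ-sym (combination-*ˡ (- 1ℚ) c e)) ⟨
        v +ᴹ - 1ℚ *ₗ combination c e  ≈⟨ +ᴹ-cong (*ₗ-identityˡ v) (*ₗ-cong refl v≈) ⟨
        1ℚ *ₗ v +ᴹ - 1ℚ *ₗ v          ≈⟨ *ₗ-distribʳ v 1ℚ (- 1ℚ) ⟨
        0ℚ *ₗ v                       ≈⟨ *ₗ-zeroˡ v ⟩
        0ᴹ                            ∎

    coord-linear : ∀ k → IsLinear (coord k)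
    coord-linear k = record
      { φ-cong = λ {v} {w} v≈w → coord-unique _ (≈ᴹ-trans v≈w (expansion w)) k
      ; φ-+    = λ v w → coord-unique _ (≈ᴹ-trans (+ᴹ-cong (expansion v) (expansion w))
                   (≈ᴹ-sym (combination-+ˡ (λ k → coord k v) (λ k → coord k w) e))) k
      ; φ-*    = λ q v → coord-unique _ (≈ᴹ-trans (*ₗ-cong refl (expansion v))
                   (≈ᴹ-sym (combination-*ˡ q (λ k → coord k v) e))) k
      }

    coord-injective : ∀ {v w} → (∀ k → coord k v ≡ coord k w) → v ≈ᴹ w
    coord-injective {v} {w} eq = begin
      v                                ≈⟨ expansion v ⟩
      combination (λ k → coord k v) e  ≈⟨ combination-cong {X = e} eq (λ _ → ≈ᴹ-refl) ⟩
      combination (λ k → coord k w) e  ≈⟨ expansion w ⟨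
      w                                ∎

    _≈?0 : ∀ v → Dec (v ≈ᴹ 0ᴹ)
    v ≈?0 = map′ (λ eq → coord-injective (λ k → trans (eq k) (sym (φ-0 (coord-linear k)))))
                 (λ v≈0 k → trans (φ-cong (coord-linear k) v≈0) (φ-0 (coord-linear k)))
                 (all? (λ k → coord k v ≟ 0ℚ))

Fin-+1 : ∀ {a p} (P : Fin (p ℕ.+ 1) → Set a) → (∀ i → P (i ↑ˡ 1)) → P (p ↑ʳ zero) → ∀ i → P i
Fin-+1 {p = p} P init last i = subst P (join-splitAt p 1 i) (cases (splitAt p i))
  where
  cases : (s : Fin p ⊎ Fin 1) → P (join p 1 s)
  cases (inj₁ i)    = init i
  cases (inj₂ zero) = last

module Quadratic {m ℓm} (V : ℚ-VectorSpace m ℓm)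
  (B : VectorSpace.Carrierᴹ V → VectorSpace.Carrierᴹ V → ℚ)
  (bilinear : VectorSpace.IsSymmetricBilinear V B) where

  open VectorSpace V
  open Form B
  open LinearAlgebra V
  open SetoidReasoning ≈ᴹ-setoid
  open IsSymmetricBilinear bilinear
  private
    module ≡ = ≡-Reasoning
    module ≤R = ≤-Reasoning

  B-linearˡ : ∀ v → IsLinear (λ u → B u v)
  B-linearˡ v = record { φ-cong = ⟦⟧-cong ; φ-+ = +ᴹ-homo ; φ-* = *ₗ-homo }
    where open LeftModuleMorphisms.IsLeftModuleHomomorphism (linear v)

  B-linearʳ : ∀ u → IsLinear (B u)
  B-linearʳ u = record
    { φ-cong = λ {v} {w} v≈w → trans (symmetric u v) (trans (φ-cong (B-linearˡ u) v≈w) (symmetric w u))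
    ; φ-+    = λ v w → trans (symmetric u (v +ᴹ w))
        (trans (φ-+ (B-linearˡ u) v w) (cong₂ _+_ (symmetric v u) (symmetric w u)))
    ; φ-*    = λ q v → trans (symmetric u (q *ₗ v)) (trans (φ-* (B-linearˡ u) q v) (cong (q *_) (symmetric v u)))
    }

  B-cong : ∀ {u u′ v v′} → u ≈ᴹ u′ → v ≈ᴹ v′ → B u v ≡ B u′ v′
  B-cong {u} {u′} {v} u≈u′ v≈v′ = trans (φ-cong (B-linearˡ v) u≈u′) (φ-cong (B-linearʳ u′) v≈v′)

  φ-vanishes : ∀ {φ} → IsLinear φ → ∀ {n} {X : Vector Carrierᴹ n} →
    (∀ i → φ (X i) ≡ 0ℚ) → ∀ c → φ (combination c X) ≡ 0ℚ
  φ-vanishes φ-lin {X = X} φX≡0 c = trans (φ-combination φ-lin c X)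
    (sum-zero _ (λ i → trans (cong (c i *_) (φX≡0 i)) (*-zeroʳ (c i))))

  unshift : ∀ v q u → v ≈ᴹ (v +ᴹ (- q) *ₗ u) +ᴹ q *ₗ u
  unshift v q u = begin
    v                                ≈⟨ +ᴹ-identityʳ v ⟨
    v +ᴹ 0ᴹ                          ≈⟨ +ᴹ-cong ≈ᴹ-refl (*ₗ-zeroˡ u) ⟨
    v +ᴹ 0ℚ *ₗ u                     ≈⟨ +ᴹ-cong ≈ᴹ-refl (*ₗ-cong (+-inverseˡ q) ≈ᴹ-refl) ⟨
    v +ᴹ (- q + q) *ₗ u              ≈⟨ +ᴹ-cong ≈ᴹ-refl (*ₗ-distribʳ u (- q) q) ⟩
    v +ᴹ ((- q) *ₗ u +ᴹ q *ₗ u)      ≈⟨ +ᴹ-assoc v _ _ ⟨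
    (v +ᴹ (- q) *ₗ u) +ᴹ q *ₗ u      ∎

  B-shift : ∀ {u} → B u u ≡ 0ℚ → ∀ {v w} → B v u ≡ 0ℚ → B w u ≡ 0ℚ →
    ∀ q r → B (v +ᴹ q *ₗ u) (w +ᴹ r *ₗ u) ≡ B v w
  B-shift {u} uu≡0 {v} {w} vu≡0 wu≡0 q r = ≡.begin
    B (v +ᴹ q *ₗ u) (w +ᴹ r *ₗ u)                        ≡.≡⟨ φ-shift (B-linearˡ _) v q u ⟩
    B v (w +ᴹ r *ₗ u) + q * B u (w +ᴹ r *ₗ u)
      ≡.≡⟨ cong₂ (λ x y → x + q * y) (φ-shift (B-linearʳ v) w r u) (φ-shift (B-linearʳ u) w r u) ⟩
    (B v w + r * B v u) + q * (B u w + r * B u u)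
      ≡.≡⟨ cong₂ (λ x y → (B v w + r * x) + q * (y + r * B u u)) vu≡0 (trans (symmetric u w) wu≡0) ⟩
    (B v w + r * 0ℚ) + q * (0ℚ + r * B u u)
      ≡.≡⟨ cong (λ x → (B v w + r * 0ℚ) + q * (0ℚ + r * x)) uu≡0 ⟩
    (B v w + r * 0ℚ) + q * (0ℚ + r * 0ℚ)                 ≡.≡⟨ ring (B v w) r q ⟩
    B v w                                                ≡.∎
    where
    ring : ∀ b r q → (b + r * 0ℚ) + q * (0ℚ + r * 0ℚ) ≡ b
    ring = solve-∀ ℚ-ring

  module Lorentzian {p : ℕ} (signature : HasSignature p 1) where
    f : Vector Carrierᴹ (p ℕ.+ 1)
    f = proj₁ signature
    f-basis = proj₁ (proj₂ signature)
    f-orthogonal = proj₁ (proj₂ (proj₂ signature))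
    f-positive = proj₁ (proj₂ (proj₂ (proj₂ signature)))

    open Coordinates f-basis public using ()
      renaming (coord to φ; coord-linear to φ-linear; expansion to f-expansion; coord-injective to φ-injective)

    τ : Carrierᴹ → ℚ
    τ = φ (p ↑ʳ zero)

    τ-linear : IsLinear τ
    τ-linear = φ-linear (p ↑ʳ zero)

    diagonalisation : ∀ v → B v v ≡ sumℚ (λ i → φ i v * φ i v * B (f i) (f i))
    diagonalisation v = ≡.begin
      B v v                                         ≡.≡⟨ B-cong (f-expansion v) ≈ᴹ-refl ⟩
      B (combination (λ i → φ i v) f) v             ≡.≡⟨ φ-combination (B-linearˡ v) (λ i → φ i v) f ⟩
      sumℚ (λ i → φ i v * B (f i) v)
        ≡.≡⟨ sum-cong-≗ (λ i → trans (cong (φ i v *_) (row i)) (sym (*-assoc (φ i v) (φ i v) (B (f i) (f i))))) ⟩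
      sumℚ (λ i → φ i v * φ i v * B (f i) (f i))    ≡.∎
      where
      row : ∀ i → B (f i) v ≡ φ i v * B (f i) (f i)
      row i = ≡.begin
        B (f i) v                              ≡.≡⟨ B-cong ≈ᴹ-refl (f-expansion v) ⟩
        B (f i) (combination (λ j → φ j v) f)  ≡.≡⟨ φ-combination (B-linearʳ (f i)) (λ j → φ j v) f ⟩
        sumℚ (λ j → φ j v * B (f i) (f j))
          ≡.≡⟨ sum-single _ i (λ j i≢j → trans (cong (φ j v *_) (f-orthogonal i j i≢j)) (*-zeroʳ (φ j v))) ⟩
        φ i v * B (f i) (f i)                  ≡.∎

    0≤square : ∀ v → τ v ≡ 0ℚ → ∀ i → 0ℚ ≤ φ i v * φ i v * B (f i) (f i)
    0≤square v τv≡0 = Fin-+1 _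
      (λ i → let a = B (f (i ↑ˡ 1)) (f (i ↑ˡ 1)) in
        subst (_≤ φ (i ↑ˡ 1) v * φ (i ↑ˡ 1) v * a) (*-zeroˡ a)
          (*-monoʳ-≤-nonNeg a {{nonNegative (<⇒≤ (f-positive i))}} (0≤p*p (φ (i ↑ˡ 1) v))))
      (≤-reflexive (sym (trans (cong (λ t → t * t * B (f (p ↑ʳ zero)) (f (p ↑ʳ zero))) τv≡0) (*-zeroˡ (B (f (p ↑ʳ zero)) (f (p ↑ʳ zero)))))))

    square≤ : ∀ v → τ v ≡ 0ℚ → ∀ i → φ i v * φ i v * B (f i) (f i) ≤ B v v
    square≤ v τv≡0 i = ≤-trans (term≤sum _ (0≤square v τv≡0) i) (≤-reflexive (sym (diagonalisation v)))

    definite : ∀ v → τ v ≡ 0ℚ → B v v ≡ 0ℚ → v ≈ᴹ 0ᴹ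
    definite v τv≡0 vv≡0 = φ-injective (λ i → trans (φ≡0 i) (sym (φ-0 (φ-linear i))))
      where
      φ≡0 : ∀ i → φ i v ≡ 0ℚ
      φ≡0 = Fin-+1 _
        (λ i → decidable-stable (φ (i ↑ˡ 1) v ≟ 0ℚ) λ φ≢0 →
          p*q≢0 (p*q≢0 φ≢0 φ≢0) (<⇒≢ (f-positive i) ∘ sym)
            (≤-antisym (≤-trans (square≤ v τv≡0 (i ↑ˡ 1)) (≤-reflexive vv≡0)) (0≤square v τv≡0 (i ↑ˡ 1))))
        τv≡0

    φ-bound : ∀ N i → ∃[ C ] ∀ v → τ v ≡ 0ℚ → B v v ≡ N → ℚ.∣ φ i v ∣ ≤ C
    φ-bound N = Fin-+1 _
      (λ i → let C , bound = square-bound _ (f-positive i) N in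
        C , λ v τv≡0 vv≡N → bound (φ (i ↑ˡ 1) v) (≤-trans (square≤ v τv≡0 (i ↑ˡ 1)) (≤-reflexive vv≡N)))
      (0ℚ , λ v τv≡0 _ → ≤-reflexive (cong ℚ.∣_∣ τv≡0))

    linear-bound : ∀ {ψ} → IsLinear ψ → ∀ N → ∃[ C ] ∀ v → τ v ≡ 0ℚ → B v v ≡ N → ℚ.∣ ψ v ∣ ≤ C
    linear-bound {ψ} ψ-linear N = _ , λ v τv≡0 vv≡N → ≤R.begin
      ℚ.∣ ψ v ∣
        ≤R.≡⟨ cong ℚ.∣_∣ (trans (φ-cong ψ-linear (f-expansion v)) (φ-combination ψ-linear (λ i → φ i v) f)) ⟩
      ℚ.∣ sumℚ (λ i → φ i v * ψ (f i)) ∣    ≤R.≤⟨ ∣sum∣≤sum _ _ (λ i → ≤-trans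
          (≤-reflexive (∣p*q∣≡∣p∣*∣q∣ (φ i v) (ψ (f i))))
          (*-monoʳ-≤-nonNeg ℚ.∣ ψ (f i) ∣ {{∣-∣-nonNeg (ψ (f i))}} (proj₂ (φ-bound N i) v τv≡0 vv≡N))) ⟩
      sumℚ (λ i → proj₁ (φ-bound N i) * ℚ.∣ ψ (f i) ∣)  ≤R.∎

    module IsotropicLine (u : Carrierᴹ) (u≉0 : u ≉ᴹ 0ᴹ) (uu≡0 : B u u ≡ 0ℚ) where

      τu⁻¹ : ∃[ r ] r * τ u ≡ 1ℚ
      τu⁻¹ = inverse (λ τu≡0 → u≉0 (definite u τu≡0 uu≡0))

      θ : Carrierᴹ → ℚ
      θ v = τ v * proj₁ τu⁻¹

      τ-project : ∀ v → τ (v +ᴹ (- θ v) *ₗ u) ≡ 0ℚ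
      τ-project v = ≡.begin
        τ (v +ᴹ (- θ v) *ₗ u)                     ≡.≡⟨ φ-shift τ-linear v (- θ v) u ⟩
        τ v + - (τ v * proj₁ τu⁻¹) * τ u          ≡.≡⟨ ring (τ v) (proj₁ τu⁻¹) (τ u) ⟩
        τ v * (1ℚ - proj₁ τu⁻¹ * τ u)             ≡.≡⟨ cong (λ x → τ v * (1ℚ - x)) (proj₂ τu⁻¹) ⟩
        τ v * 0ℚ                                  ≡.≡⟨ *-zeroʳ (τ v) ⟩
        0ℚ                                        ≡.∎
        where
        ring : ∀ t r s → t + - (t * r) * s ≡ t * (1ℚ - r * s)
        ring = solve-∀ ℚ-ring

      isotropic⇒multiple : ∀ v → B v u ≡ 0ℚ → B v v ≡ 0ℚ → v ≈ᴹ θ v *ₗ u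
      isotropic⇒multiple v vu≡0 vv≡0 = begin
        v                                   ≈⟨ unshift v (θ v) u ⟩
        (v +ᴹ (- θ v) *ₗ u) +ᴹ θ v *ₗ u
          ≈⟨ +ᴹ-cong (definite _ (τ-project v) (trans (B-shift uu≡0 vu≡0 vu≡0 _ _) vv≡0)) ≈ᴹ-refl ⟩
        0ᴹ +ᴹ θ v *ₗ u                      ≈⟨ +ᴹ-identityˡ _ ⟩
        θ v *ₗ u                            ∎

      reduced-bound : ∀ {ψ} → IsLinear ψ → ∀ N D → ∃[ C ] ∀ v q → B v u ≡ 0ℚ → B v v ≡ N →
        ℚ.∣ θ v + q ∣ ≤ D → ℚ.∣ ψ (v +ᴹ q *ₗ u) ∣ ≤ C
      reduced-bound {ψ} ψ-linear N D = C + D * ℚ.∣ ψ u ∣ , bound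
        where
        C = proj₁ (linear-bound ψ-linear N)
        ring : ∀ a q b t → a + q * b ≡ (a + - t * b) + (t + q) * b
        ring = solve-∀ ℚ-ring
        bound : ∀ v q → B v u ≡ 0ℚ → B v v ≡ N → ℚ.∣ θ v + q ∣ ≤ D → ℚ.∣ ψ (v +ᴹ q *ₗ u) ∣ ≤ C + D * ℚ.∣ ψ u ∣
        bound v q vu≡0 vv≡N θ+q≤D = ≤R.begin
          ℚ.∣ ψ (v +ᴹ q *ₗ u) ∣                     ≤R.≡⟨ cong ℚ.∣_∣ decompose ⟩
          ℚ.∣ ψ v′ + (θ v + q) * ψ u ∣              ≤R.≤⟨ ∣p+q∣≤∣p∣+∣q∣ (ψ v′) ((θ v + q) * ψ u) ⟩
          ℚ.∣ ψ v′ ∣ + ℚ.∣ (θ v + q) * ψ u ∣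
            ≤R.≡⟨ cong (_+_ ℚ.∣ ψ v′ ∣) (∣p*q∣≡∣p∣*∣q∣ (θ v + q) (ψ u)) ⟩
          ℚ.∣ ψ v′ ∣ + ℚ.∣ θ v + q ∣ * ℚ.∣ ψ u ∣
            ≤R.≤⟨ +-mono-≤ (proj₂ (linear-bound ψ-linear N) v′ (τ-project v) (trans (B-shift uu≡0 vu≡0 vu≡0 (- θ v) (- θ v)) vv≡N))
                           (*-monoʳ-≤-nonNeg ℚ.∣ ψ u ∣ {{∣-∣-nonNeg (ψ u)}} θ+q≤D) ⟩
          C + D * ℚ.∣ ψ u ∣                 ≤R.∎
          where
          v′ = v +ᴹ (- θ v) *ₗ u
          decompose : ψ (v +ᴹ q *ₗ u) ≡ ψ v′ + (θ v + q) * ψ u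
          decompose = ≡.begin
            ψ (v +ᴹ q *ₗ u)                               ≡.≡⟨ φ-shift ψ-linear v q u ⟩
            ψ v + q * ψ u                                 ≡.≡⟨ ring (ψ v) q (ψ u) (θ v) ⟩
            (ψ v + - θ v * ψ u) + (θ v + q) * ψ u
              ≡.≡⟨ cong (_+ (θ v + q) * ψ u) (φ-shift ψ-linear v (- θ v) u) ⟨
            ψ v′ + (θ v + q) * ψ u                        ≡.∎

      module KernelVector {n : ℕ} (β : Vector (Vector ℚ n) n) (k : Vector ℚ n) (k≢0 : ∃[ i ] k i ≢ 0ℚ)
        (k-unique : ∀ (c : Vector ℚ n) → (∀ i → sumℚ (λ j → c j * β i j) ≡ 0ℚ) → ∃[ t ] ∀ j → c j ≡ t * k j)
        (k-kernel : ∀ i → sumℚ (λ j → k j * β i j) ≡ 0ℚ)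
        {b : Level} (ℓ : Subspace b) (u∈ℓ : u ∈ ∣ ℓ ∣)
        (ℓ⊆ : ∀ {v : Carrierᴹ} → v ∈ ∣ ℓ ∣ → ∃[ t ] v ≈ᴹ t *ₗ u) where

        -- For tuples with Gram matrix 2β orthogonal to u, the relation k sends X into ℚu, and
        -- R(X) = ℓ exactly when it does not kill X; unlike R(X) = ℓ, this is visibly decidable.
        Admissible : Vector Carrierᴹ n → Set ℓm
        Admissible X = (∀ i j → ½ * B (X i) (X j) ≡ β i j) × (∀ i → B (X i) u ≡ 0ℚ) × combination k X ≉ᴹ 0ᴹ

        half-zero : ∀ {x} → ½ * x ≡ 0ℚ → x ≡ 0ℚ
        half-zero {x} ½x≡0 = decidable-stable (x ≟ 0ℚ) λ x≢0 → p*q≢0 {½} (λ ()) x≢0 ½x≡0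

        module _ {X : Vector Carrierᴹ n} (gram : ∀ i j → ½ * B (X i) (X j) ≡ β i j) where

          gram-combination : ∀ c i → ½ * B (X i) (combination c X) ≡ sumℚ (λ j → c j * β i j)
          gram-combination c i = ≡.begin
            ½ * B (X i) (combination c X)
              ≡.≡⟨ cong (½ *_) (φ-combination (B-linearʳ (X i)) c X) ⟩
            ½ * sumℚ (λ j → c j * B (X i) (X j))
              ≡.≡⟨ *-distribˡ-sum ½ (λ j → c j * B (X i) (X j)) ⟩
            sumℚ (λ j → ½ * (c j * B (X i) (X j)))
              ≡.≡⟨ sum-cong-≗ (λ j → trans (swap ½ (c j) (B (X i) (X j))) (cong (c j *_) (gram i j))) ⟩
            sumℚ (λ j → c j * β i j)                    ≡.∎
            where
            swap : ∀ h c b → h * (c * b) ≡ c * (h * b)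
            swap = solve-∀ ℚ-ring

          relation-multiple : ∀ c → (∀ i → B (X i) (combination c X) ≡ 0ℚ) →
            ∃[ t ] (∀ j → c j ≡ t * k j) × combination c X ≈ᴹ t *ₗ combination k X
          relation-multiple c cX⊥X =
            let t , c≡tk = k-unique c (λ i → trans (sym (gram-combination c i)) (trans (cong (½ *_) (cX⊥X i)) (*-zeroʳ ½)))
            in t , c≡tk , ≈ᴹ-trans (combination-cong {X = X} c≡tk (λ _ → ≈ᴹ-refl)) (combination-*ˡ t k X)

          kernel-orthogonal : ∀ i → B (X i) (combination k X) ≡ 0ℚ
          kernel-orthogonal i = half-zero (trans (gram-combination k i) (k-kernel i))

        module _ {X : Vector Carrierᴹ n} (X-admissible : Admissible X) where
          private
            gram = proj₁ X-admissible
            X⊥u = proj₁ (proj₂ X-admissible)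
            w = combination k X
            w≉0 = proj₂ (proj₂ X-admissible)

          w≈θu : w ≈ᴹ θ w *ₗ u
          w≈θu = isotropic⇒multiple w (φ-vanishes (B-linearˡ u) X⊥u k)
            (φ-vanishes (B-linearˡ w) (kernel-orthogonal gram) k)

          u∈Span : u ∈ Span X
          u∈Span = Subspace.≈-resp (span X)
              (≈ᴹ-trans (*ₗ-cong refl w≈θu) (≈ᴹ-sym (scale-inverse (proj₁ θ⁻¹) (θ w) u (proj₂ θ⁻¹))))
              (Subspace.*-mem (span X) (proj₁ θ⁻¹) (k , ≈ᴹ-refl))
            where
            θ⁻¹ : ∃[ r ] r * θ w ≡ 1ℚ
            θ⁻¹ = inverse (λ θ≡0 → w≉0 (≈ᴹ-trans w≈θu (≈ᴹ-trans (*ₗ-cong θ≡0 ≈ᴹ-refl) (*ₗ-zeroˡ u))))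

          Span⊥u : ∀ {v} → v ∈ Span X → B v u ≡ 0ℚ
          Span⊥u (c , v≈) = trans (φ-cong (B-linearˡ u) v≈) (φ-vanishes (B-linearˡ u) X⊥u c)

          Span⊆ℓ^⊥ : Span X ⊆ ∣ ℓ ∣ ^⊥
          Span⊆ℓ^⊥ {v} v∈ x x∈ℓ = let t , x≈tu = ℓ⊆ x∈ℓ in
            trans (φ-cong (B-linearʳ v) x≈tu) (trans (φ-* (B-linearʳ v) t u)
              (trans (cong (t *_) (Span⊥u v∈)) (*-zeroʳ t)))

          admissible⇒Ω : X ∈ Ω β ℓ
          admissible⇒Ω = gram , R⊆ℓ , ℓ⊆R
            where
            R⊆ℓ : R X ⊆ ∣ ℓ ∣
            R⊆ℓ {v} (v∈ , v⊥) = Subspace.≈-resp ℓ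
              (≈ᴹ-sym (isotropic⇒multiple v (Span⊥u v∈) (v⊥ v v∈))) (Subspace.*-mem ℓ (θ v) u∈ℓ)
            ℓ⊆R : ∣ ℓ ∣ ⊆ R X
            ℓ⊆R {x} x∈ℓ = let t , x≈tu = ℓ⊆ x∈ℓ in
                Subspace.≈-resp (span X) (≈ᴹ-sym x≈tu) (Subspace.*-mem (span X) t u∈Span)
              , λ v v∈ → trans (symmetric x v) (Span⊆ℓ^⊥ v∈ x x∈ℓ)

          independent : LinearlyIndependent X
          independent c cX≈0 i = trans (c≡tk i) (trans (cong (_* k i) t≡0) (*-zeroˡ (k i)))
            where
            multiple = relation-multiple gram c (λ i → trans (φ-cong (B-linearʳ (X i)) cX≈0) (φ-0 (B-linearʳ (X i))))
            t = proj₁ multiple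
            c≡tk = proj₁ (proj₂ multiple)
            t≡0 : t ≡ 0ℚ
            t≡0 = decidable-stable (t ≟ 0ℚ) λ t≢0 →
              scale-≉0 t≢0 w≉0 (≈ᴹ-trans (≈ᴹ-sym (proj₂ (proj₂ multiple))) cX≈0)

          shift-admissible : ∀ {Y} (q : Vector ℚ n) → (∀ i → Y i ≈ᴹ X i +ᴹ q i *ₗ u) →
            combination k Y ≉ᴹ 0ᴹ → Admissible Y
          shift-admissible q Y≈ kY≉0 =
              (λ i j → trans (cong (½ *_) (trans (B-cong (Y≈ i) (Y≈ j)) (B-shift uu≡0 (X⊥u i) (X⊥u j) (q i) (q j)))) (gram i j))
            , (λ i → trans (φ-cong (B-linearˡ u) (Y≈ i)) (trans (φ-shift (B-linearˡ u) (X i) (q i) u)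
                (trans (cong₂ (λ x y → x + q i * y) (X⊥u i) uu≡0) (trans (+-identityˡ _) (*-zeroʳ (q i))))))
            , kY≉0

        Ω⇒admissible : ∀ {X} → X ∈ Ω β ℓ → Admissible X
        Ω⇒admissible {X} (gram , R⊆ℓ , ℓ⊆R) = gram , (λ i → trans (symmetric (X i) u) (u⊥ (X i) (∈-Span X i))) , w≉0
          where
          u∈ = proj₁ (ℓ⊆R u∈ℓ)
          c = proj₁ u∈
          u≈cX = proj₂ u∈
          u⊥ = proj₂ (ℓ⊆R u∈ℓ)
          w≉0 : combination k X ≉ᴹ 0ᴹ
          w≉0 w≈0 = let t , _ , cX≈tw = relation-multiple gram c (λ i →
                          trans (φ-cong (B-linearʳ (X i)) (≈ᴹ-sym u≈cX)) (trans (symmetric (X i) u) (u⊥ (X i) (∈-Span X i))))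
            in u≉0 (begin
              u                       ≈⟨ u≈cX ⟩
              combination c X         ≈⟨ cX≈tw ⟩
              t *ₗ combination k X    ≈⟨ *ₗ-cong refl w≈0 ⟩
              t *ₗ 0ᴹ                 ≈⟨ *ₗ-zeroʳ t ⟩
              0ᴹ                      ∎)

        shift-Span : ∀ {X Y} (q : Vector ℚ n) → Admissible X → Admissible Y →
          (∀ i → Y i ≈ᴹ X i +ᴹ q i *ₗ u) → Span Y ≐ Span X
        shift-Span {X} {Y} q X-adm Y-adm Y≈ = Span-⊆ (span X) Y∈ , Span-⊆ (span Y) X∈
          where
          open Subspace
          Y∈ : ∀ i → Y i ∈ Span X
          Y∈ i = ≈-resp (span X) (≈ᴹ-sym (Y≈ i)) (+-mem (span X) (∈-Span X i) (*-mem (span X) (q i) (u∈Span X-adm)))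
          X≈ : ∀ i → Y i +ᴹ (- q i) *ₗ u ≈ᴹ X i
          X≈ i = begin
            Y i +ᴹ (- q i) *ₗ u                          ≈⟨ +ᴹ-cong (Y≈ i) ≈ᴹ-refl ⟩
            (X i +ᴹ q i *ₗ u) +ᴹ (- q i) *ₗ u            ≈⟨ +ᴹ-assoc _ _ _ ⟩
            X i +ᴹ (q i *ₗ u +ᴹ (- q i) *ₗ u)
              ≈⟨ +ᴹ-cong ≈ᴹ-refl (*ₗ-distribʳ u (q i) (- q i)) ⟨
            X i +ᴹ (q i + - q i) *ₗ u
              ≈⟨ +ᴹ-cong ≈ᴹ-refl (*ₗ-cong (+-inverseʳ (q i)) ≈ᴹ-refl) ⟩
            X i +ᴹ 0ℚ *ₗ u                               ≈⟨ +ᴹ-cong ≈ᴹ-refl (*ₗ-zeroˡ u) ⟩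
            X i +ᴹ 0ᴹ                                    ≈⟨ +ᴹ-identityʳ _ ⟩
            X i                                          ∎
          X∈ : ∀ i → X i ∈ Span Y
          X∈ i = ≈-resp (span Y) (X≈ i) (+-mem (span Y) (∈-Span Y i) (*-mem (span Y) (- q i) (u∈Span Y-adm)))

        -- Translating one entry with nonzero coefficient by u changes the value of the relation k.
        bump : (∀ v → Dec (v ≈ᴹ 0ᴹ)) → ∀ X → Σ[ b ∈ Vector ℤ n ] (∀ i → ℚ.∣ b i / 1 ∣ ≤ 1ℚ) ×
          combination k (λ i → X i +ᴹ (b i / 1) *ₗ u) ≉ᴹ 0ᴹ
        bump _≈?0 X = case combination k X ≈?0 of λ where
            (no w≉0)  → (λ _ → 0ℤ) , (λ _ → nonNegative⁻¹ 1ℚ) , λ eq → w≉0 (begin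
                combination k X                          ≈⟨ +ᴹ-identityʳ _ ⟨
                combination k X +ᴹ 0ᴹ                    ≈⟨ +ᴹ-cong ≈ᴹ-refl (*ₗ-zeroˡ u) ⟨
                combination k X +ᴹ 0ℚ *ₗ u
                  ≈⟨ +ᴹ-cong ≈ᴹ-refl (*ₗ-cong (sum-zero _ (λ i → *-zeroʳ (k i))) ≈ᴹ-refl) ⟨
                combination k X +ᴹ sumℚ (λ i → k i * 0ℚ) *ₗ u  ≈⟨ split (λ _ → 0ℤ) ⟨
                combination k (λ i → X i +ᴹ 0ℚ *ₗ u)     ≈⟨ eq ⟩
                0ᴹ                                       ∎)
            (yes w≈0) → unit , unit-bound , λ eq → scale-≉0 (proj₂ k≢0) u≉0 (begin
                k i₀ *ₗ u                                                  ≈⟨ *ₗ-cong sum-unit ≈ᴹ-refl ⟨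
                sumℚ (λ i → k i * (unit i / 1)) *ₗ u                       ≈⟨ +ᴹ-identityˡ _ ⟨
                0ᴹ +ᴹ sumℚ (λ i → k i * (unit i / 1)) *ₗ u                 ≈⟨ +ᴹ-cong w≈0 ≈ᴹ-refl ⟨
                combination k X +ᴹ sumℚ (λ i → k i * (unit i / 1)) *ₗ u    ≈⟨ split unit ⟨
                combination k (λ i → X i +ᴹ (unit i / 1) *ₗ u)             ≈⟨ eq ⟩
                0ᴹ                                                         ∎)
          where
          i₀ = proj₁ k≢0
          unit : Vector ℤ n
          unit i = if does (i₀ Fin.≟ i) then 1ℤ else 0ℤ
          unit-bound : ∀ i → ℚ.∣ unit i / 1 ∣ ≤ 1ℚ
          unit-bound i with i₀ Fin.≟ i
          ... | yes _ = ≤-refl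
          ... | no  _ = nonNegative⁻¹ 1ℚ
          unit-diagonal : unit i₀ ≡ 1ℤ
          unit-diagonal with i₀ Fin.≟ i₀
          ... | yes _     = refl
          ... | no  i₀≢i₀ = contradiction refl i₀≢i₀
          unit-off : ∀ i → i₀ ≢ i → unit i ≡ 0ℤ
          unit-off i i₀≢i with i₀ Fin.≟ i
          ... | yes i₀≡i = contradiction i₀≡i i₀≢i
          ... | no  _    = refl
          sum-unit : sumℚ (λ i → k i * (unit i / 1)) ≡ k i₀
          sum-unit = trans
            (sum-single _ i₀ (λ i i₀≢i → trans (cong (λ z → k i * (z / 1)) (unit-off i i₀≢i)) (*-zeroʳ (k i))))
            (trans (cong (λ z → k i₀ * (z / 1)) unit-diagonal) (*-identityʳ (k i₀)))
          split : ∀ b → combination k (λ i → X i +ᴹ (b i / 1) *ₗ u) ≈ᴹ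
            combination k X +ᴹ sumℚ (λ i → k i * (b i / 1)) *ₗ u
          split b = ≈ᴹ-trans (combination-+ʳ k X (λ i → (b i / 1) *ₗ u))
            (+ᴹ-cong ≈ᴹ-refl (combination-multiples k (λ i → b i / 1) u))

        module Enumeration {a : Level} {d : ℕ} {e : Vector Carrierᴹ d} (e-basis : IsBasis U e)
          (L : Pred Carrierᴹ a) (L≐ : L ≐ ℤ-Span e) (u∈L : u ∈ ℤ-Span e) (h : Vector Carrierᴹ n) where

          open Coordinates e-basis

          lattice-point : Vector ℤ d → Carrierᴹ
          lattice-point z = combination (λ k → z k / 1) e

          lattice-shift : ∀ {x h} z m → x -ᴹ h ≈ᴹ lattice-point z →
            x +ᴹ (m / 1) *ₗ u ≈ᴹ h +ᴹ lattice-point (λ k → z k ℤ.+ m ℤ.* proj₁ u∈L k)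
          lattice-shift {x} {h} z m x-h≈ = begin
            x +ᴹ (m / 1) *ₗ u                                          ≈⟨ +ᴹ-cong split mu≈ ⟩
            (h +ᴹ lattice-point z) +ᴹ lattice-point mu                 ≈⟨ +ᴹ-assoc h _ _ ⟩
            h +ᴹ (lattice-point z +ᴹ lattice-point mu)
              ≈⟨ +ᴹ-cong ≈ᴹ-refl (combination-+ˡ _ _ e) ⟨
            h +ᴹ combination (λ k → z k / 1 + mu k / 1) e
              ≈⟨ +ᴹ-cong ≈ᴹ-refl (combination-cong {X = e} (λ k → /1-+ (z k) (mu k)) (λ _ → ≈ᴹ-refl)) ⟨
            h +ᴹ lattice-point (λ k → z k ℤ.+ mu k)                    ∎
            where
            mu : Vector ℤ d
            mu k = m ℤ.* proj₁ u∈L k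
            mu≈ : (m / 1) *ₗ u ≈ᴹ lattice-point mu
            mu≈ = begin
              (m / 1) *ₗ u                                  ≈⟨ *ₗ-cong refl (proj₂ u∈L) ⟩
              (m / 1) *ₗ lattice-point (proj₁ u∈L)          ≈⟨ combination-*ˡ (m / 1) _ e ⟨
              combination (λ k → (m / 1) * (proj₁ u∈L k / 1)) e
                ≈⟨ combination-cong {X = e} (λ k → /1-* m (proj₁ u∈L k)) (λ _ → ≈ᴹ-refl) ⟨
              lattice-point mu                              ∎
            split : x ≈ᴹ h +ᴹ lattice-point z
            split = begin
              x                        ≈⟨ +ᴹ-identityʳ x ⟨
              x +ᴹ 0ᴹ                  ≈⟨ +ᴹ-cong ≈ᴹ-refl (-ᴹ‿inverseˡ h) ⟨
              x +ᴹ (-ᴹ h +ᴹ h)         ≈⟨ +ᴹ-assoc x _ _ ⟨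
              (x -ᴹ h) +ᴹ h            ≈⟨ +ᴹ-cong x-h≈ ≈ᴹ-refl ⟩
              lattice-point z +ᴹ h     ≈⟨ +ᴹ-comm _ h ⟩
              h +ᴹ lattice-point z     ∎

          coset-bound : ∀ h N → ∃[ K ] ∀ x q z → B x u ≡ 0ℚ → B x x ≡ N → ℚ.∣ θ x + q ∣ ≤ 1ℚ + 1ℚ →
            x +ᴹ q *ₗ u ≈ᴹ h +ᴹ lattice-point z → ∀ k → ℤ.∣ z k ∣ ℕ.≤ K
          coset-bound h N = proj₁ (family-bound K) , λ x q z xu≡0 xx≡N θ+q≤2 x+qu≈ k →
              ℕ.≤-trans (proj₂ (integer-bound (Q k)) (z k) (z≤Q x q z xu≡0 xx≡N θ+q≤2 x+qu≈ k))
                (proj₂ (family-bound K) k)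
            where
            C : Fin d → ℚ
            C k = proj₁ (reduced-bound (coord-linear k) N (1ℚ + 1ℚ))
            Q : Fin d → ℚ
            Q k = C k + ℚ.∣ coord k h ∣
            K : Fin d → ℕ
            K k = proj₁ (integer-bound (Q k))
            z≤Q : ∀ x q z → B x u ≡ 0ℚ → B x x ≡ N → ℚ.∣ θ x + q ∣ ≤ 1ℚ + 1ℚ →
              x +ᴹ q *ₗ u ≈ᴹ h +ᴹ lattice-point z → ∀ k → ℚ.∣ z k / 1 ∣ ≤ Q k
            z≤Q x q z xu≡0 xx≡N θ+q≤2 x+qu≈ k = ≤R.begin
              ℚ.∣ z k / 1 ∣                                            ≤R.≡⟨ cong ℚ.∣_∣ z≡ ⟩
              ℚ.∣ coord k (x +ᴹ q *ₗ u) - coord k h ∣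
                ≤R.≤⟨ ∣p-q∣≤∣p∣+∣q∣ (coord k (x +ᴹ q *ₗ u)) (coord k h) ⟩
              ℚ.∣ coord k (x +ᴹ q *ₗ u) ∣ + ℚ.∣ coord k h ∣
                ≤R.≤⟨ +-monoˡ-≤ ℚ.∣ coord k h ∣ (proj₂ (reduced-bound (coord-linear k) N (1ℚ + 1ℚ)) x q xu≡0 xx≡N θ+q≤2) ⟩
              Q k                                                      ≤R.∎
              where
              ring : ∀ a b → a ≡ (b + a) - b
              ring = solve-∀ ℚ-ring
              z≡ : z k / 1 ≡ coord k (x +ᴹ q *ₗ u) - coord k h
              z≡ = ≡.begin
                z k / 1                                      ≡.≡⟨ ring (z k / 1) (coord k h) ⟩
                (coord k h + z k / 1) - coord k h
                  ≡.≡⟨ cong (λ c → (coord k h + c) - coord k h) (coord-unique (λ k → z k / 1) ≈ᴹ-refl k) ⟨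
                (coord k h + coord k (lattice-point z)) - coord k h
                  ≡.≡⟨ cong (_- coord k h) (φ-+ (coord-linear k) h (lattice-point z)) ⟨
                coord k (h +ᴹ lattice-point z) - coord k h
                  ≡.≡⟨ cong (_- coord k h) (φ-cong (coord-linear k) x+qu≈) ⟨
                coord k (x +ᴹ q *ₗ u) - coord k h            ≡.∎

          point : (Fin n → Vector ℤ d) → Vector Carrierᴹ n
          point z i = h i +ᴹ lattice-point (z i)

          point∈Coset : ∀ z → point z ∈ Coset L h
          point∈Coset z i = proj₂ L≐ (z i , (begin
            (h i +ᴹ lattice-point (z i)) +ᴹ -ᴹ h i   ≈⟨ +ᴹ-cong (+ᴹ-comm (h i) _) ≈ᴹ-refl ⟩
            (lattice-point (z i) +ᴹ h i) +ᴹ -ᴹ h i   ≈⟨ +ᴹ-assoc _ (h i) _ ⟩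
            lattice-point (z i) +ᴹ (h i +ᴹ -ᴹ h i)   ≈⟨ +ᴹ-cong ≈ᴹ-refl (-ᴹ‿inverseʳ (h i)) ⟩
            lattice-point (z i) +ᴹ 0ᴹ                ≈⟨ +ᴹ-identityʳ _ ⟩
            lattice-point (z i)                      ∎))

          admissible? : ∀ X → Dec (Admissible X)
          admissible? X = all? (λ i → all? (λ j → ½ * B (X i) (X j) ≟ β i j))
            ×-dec all? (λ i → B (X i) u ≟ 0ℚ) ×-dec ¬? (combination k X ≈?0)

          bounded-representative : ∃[ K ] ∀ {X} → Admissible X → X ∈ Coset L h →
            Σ[ z ∈ (Fin n → Vector ℤ d) ] (∀ i k → ℤ.∣ z i k ∣ ℕ.≤ K) ×
              (∀ z′ → (∀ i k → z′ i k ≡ z i k) → Admissible (point z′) × Span (point z′) ≐ Span X)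
          bounded-representative = proj₁ (family-bound K) , representative
            where
            K : Fin n → ℕ
            K i = proj₁ (coset-bound (h i) ((1ℚ + 1ℚ) * β i i))
            representative : ∀ {X} → Admissible X → X ∈ Coset L h →
              Σ[ z ∈ (Fin n → Vector ℤ d) ] (∀ i k → ℤ.∣ z i k ∣ ℕ.≤ proj₁ (family-bound K)) ×
                (∀ z′ → (∀ i k → z′ i k ≡ z i k) → Admissible (point z′) × Span (point z′) ≐ Span X)
            representative {X} X-adm@(gram , X⊥u , _) X∈ = z , z≤K , near
              where
              μ : Vector ℤ n
              μ i = proj₁ (fractional-shift (θ (X i)))
              bumped = bump _≈?0 (λ i → X i +ᴹ (μ i / 1) *ₗ u)
              ν = proj₁ bumped
              q : Vector ℚ n
              q i = (μ i ℤ.+ ν i) / 1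
              q≡ : ∀ i → q i ≡ μ i / 1 + ν i / 1
              q≡ i = /1-+ (μ i) (ν i)
              zX : Fin n → Vector ℤ d
              zX i = proj₁ (proj₁ L≐ (X∈ i))
              z : Fin n → Vector ℤ d
              z i k = zX i k ℤ.+ (μ i ℤ.+ ν i) ℤ.* proj₁ u∈L k
              X+qu≈ : ∀ i → X i +ᴹ q i *ₗ u ≈ᴹ h i +ᴹ lattice-point (z i)
              X+qu≈ i = lattice-shift (zX i) (μ i ℤ.+ ν i) (proj₂ (proj₁ L≐ (X∈ i)))
              θ+q≤2 : ∀ i → ℚ.∣ θ (X i) + q i ∣ ≤ 1ℚ + 1ℚ
              θ+q≤2 i = ≤R.begin
                ℚ.∣ θ (X i) + q i ∣
                  ≤R.≡⟨ cong (λ x → ℚ.∣ θ (X i) + x ∣) (q≡ i) ⟩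
                ℚ.∣ θ (X i) + (μ i / 1 + ν i / 1) ∣
                  ≤R.≡⟨ cong ℚ.∣_∣ (+-assoc (θ (X i)) (μ i / 1) (ν i / 1)) ⟨
                ℚ.∣ (θ (X i) + μ i / 1) + ν i / 1 ∣
                  ≤R.≤⟨ ∣p+q∣≤∣p∣+∣q∣ (θ (X i) + μ i / 1) (ν i / 1) ⟩
                ℚ.∣ θ (X i) + μ i / 1 ∣ + ℚ.∣ ν i / 1 ∣
                  ≤R.≤⟨ +-mono-≤ (proj₂ (fractional-shift (θ (X i)))) (proj₁ (proj₂ bumped) i) ⟩
                1ℚ + 1ℚ                                         ≤R.∎
              norm : ∀ i → B (X i) (X i) ≡ (1ℚ + 1ℚ) * β i i
              norm i = ≡.begin
                B (X i) (X i)                          ≡.≡⟨ *-identityˡ _ ⟨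
                (1ℚ + 1ℚ) * ½ * B (X i) (X i)          ≡.≡⟨ *-assoc (1ℚ + 1ℚ) ½ (B (X i) (X i)) ⟩
                (1ℚ + 1ℚ) * (½ * B (X i) (X i))        ≡.≡⟨ cong ((1ℚ + 1ℚ) *_) (gram i i) ⟩
                (1ℚ + 1ℚ) * β i i                      ≡.∎
              z≤K : ∀ i k → ℤ.∣ z i k ∣ ℕ.≤ proj₁ (family-bound K)
              z≤K i k = ℕ.≤-trans
                (proj₂ (coset-bound (h i) ((1ℚ + 1ℚ) * β i i)) (X i) (q i) (z i) (X⊥u i) (norm i) (θ+q≤2 i) (X+qu≈ i) k)
                (proj₂ (family-bound K) i)
              near : ∀ z′ → (∀ i k → z′ i k ≡ z i k) → Admissible (point z′) × Span (point z′) ≐ Span X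
              near z′ z′≡z = Y-adm , shift-Span q X-adm Y-adm Y≈
                where
                Y≈ : ∀ i → point z′ i ≈ᴹ X i +ᴹ q i *ₗ u
                Y≈ i = ≈ᴹ-trans
                  (+ᴹ-cong ≈ᴹ-refl (combination-cong {X = e} (λ k → cong (_/ 1) (z′≡z i k)) (λ _ → ≈ᴹ-refl)))
                  (≈ᴹ-sym (X+qu≈ i))
                Y-adm : Admissible (point z′)
                Y-adm = shift-admissible X-adm q Y≈ λ kY≈0 → proj₂ (proj₂ bumped) (≈ᴹ-trans
                  (combination-cong {c = k} (λ _ → refl) λ i → begin
                    (X i +ᴹ (μ i / 1) *ₗ u) +ᴹ (ν i / 1) *ₗ u     ≈⟨ +ᴹ-assoc (X i) _ _ ⟩
                    X i +ᴹ ((μ i / 1) *ₗ u +ᴹ (ν i / 1) *ₗ u)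
                      ≈⟨ +ᴹ-cong ≈ᴹ-refl (*ₗ-distribʳ u (μ i / 1) (ν i / 1)) ⟨
                    X i +ᴹ (μ i / 1 + ν i / 1) *ₗ u
                      ≈⟨ +ᴹ-cong ≈ᴹ-refl (*ₗ-cong (q≡ i) ≈ᴹ-refl) ⟨
                    X i +ᴹ q i *ₗ u                               ≈⟨ Y≈ i ⟨
                    point z′ i                                    ∎)
                  kY≈0)

          finitely-many-spans : ∃[ κ ] Σ[ W ∈ Vector (Subspace ℓm) κ ]
            (∀ i → HasDimension ∣ W i ∣ n × ∣ W i ∣ ⊆ ∣ ℓ ∣ ^⊥) ×
            (∀ i → ∃[ X ] X ∈ Ω β ℓ × X ∈ Coset L h × ∣ W i ∣ ≐ Span X) ×
            (∀ X → X ∈ Ω β ℓ → X ∈ Coset L h → ∃[ i ] ∣ W i ∣ ≐ Span X)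
          finitely-many-spans =
            let K , representative = bounded-representative
                _ , decode , hits = bounded-matrices n d K
                κ , g , g-admissible , g-complete = enumerate-satisfying (λ j → admissible? (point (decode j)))
            in κ , (λ i → span (point (decode (g i))))
             , (λ i → (point (decode (g i)) , independent (g-admissible i) , id , id) , Span⊆ℓ^⊥ (g-admissible i))
             , (λ i → point (decode (g i)) , admissible⇒Ω (g-admissible i) , point∈Coset (decode (g i)) , id , id)
             , λ X X∈Ω X∈Coset →
                 let z , z≤K , near = representative (Ω⇒admissible X∈Ω) X∈Coset
                     j , decode≡z = hits z z≤K
                     Y-adm , spans≐ = near (decode j) decode≡z
                     i , gi≡j = g-complete j Y-adm
                 in i , subst (λ j → Span (point (decode j)) ≐ Span X) (sym gi≡j) spans≐

lemma3p2 : ∀ {m ℓm a b} (V : ℚ-VectorSpace m ℓm) → let open VectorSpace V in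
    (B : Carrierᴹ → Carrierᴹ → ℚ) → let open Form B in
    (p n : ℕ) →
    HasDimension U (p ℕ.+ 1) →
    IsSymmetricBilinear B →
    NonDegenerate →
    HasSignature p 1 →
    (∃[ v ] v ≉ᴹ 0ᴹ × v ∈ IsIsotropic) →
    (L : Pred Carrierᴹ a) → IsFullLattice L → L ⊆ L ^# →
    1 ℕ.≤ n → n ℕ.≤ p →
    (h : Vector Carrierᴹ n) → (∀ i → h i ∈ L ^#) →
    (β : Vector (Vector ℚ n) n) →
    IsSymmetricMatrix β → IsPositiveSemidefinite β → HasRank β (n ℕ.∸ 1) →
    (ℓ : Subspace b) → IsIsotropicLine ℓ →
    ∃[ k ] Σ[ W ∈ Vector (Subspace ℓm) k ]
    (∀ i → HasDimension ∣ W i ∣ n × ∣ W i ∣ ⊆ ∣ ℓ ∣ ^⊥) ×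
    (∀ i → ∃[ X ] X ∈ Ω β ℓ × X ∈ Coset L h × ∣ W i ∣ ≐ Span X) ×
    (∀ X → X ∈ Ω β ℓ → X ∈ Coset L h → ∃[ i ] ∣ W i ∣ ≐ Span X)
lemma3p2 V B p (suc n) _ bilinear _ signature _ L (d , e , e-basis , L≐) _ (s≤s _) _ h _ β _ _ rank
  ℓ ((g , g-independent , ℓ⊆g , g⊆ℓ) , isotropic) = finitely-many-spans
  where
  open VectorSpace V
  open Form B
  open LinearAlgebra V
  open SetoidReasoning ≈ᴹ-setoid
  open Coordinates e-basis

  g₀ : Carrierᴹ
  g₀ = g zero

  g₀≉0 : g₀ ≉ᴹ 0ᴹ
  g₀≉0 g₀≈0 = contradiction (g-independent (λ _ → 1ℚ) (begin
    1ℚ *ₗ g₀ +ᴹ 0ᴹ  ≈⟨ +ᴹ-identityʳ _ ⟩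
    1ℚ *ₗ g₀        ≈⟨ *ₗ-identityˡ g₀ ⟩
    g₀              ≈⟨ g₀≈0 ⟩
    0ᴹ              ∎) zero) 1≢0

  denominator = common-denominator (λ k → coord k g₀)

  D : ℚ
  D = proj₁ denominator / 1

  D≢0 : D ≢ 0ℚ
  D≢0 = proj₁ (proj₂ denominator)

  u : Carrierᴹ
  u = D *ₗ g₀

  u∈ℓ : u ∈ ∣ ℓ ∣
  u∈ℓ = Subspace.*-mem ℓ D (g⊆ℓ (∈-Span g zero))

  ℓ⊆ℚu : ∀ {v} → v ∈ ∣ ℓ ∣ → ∃[ t ] v ≈ᴹ t *ₗ u
  ℓ⊆ℚu {v} v∈ℓ = let c , v≈ = ℓ⊆g v∈ℓ ; r , rD≡1 = inverse D≢0 in c zero * r , (begin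
    v                          ≈⟨ v≈ ⟩
    c zero *ₗ g₀ +ᴹ 0ᴹ         ≈⟨ +ᴹ-identityʳ _ ⟩
    c zero *ₗ g₀               ≈⟨ *ₗ-cong refl (scale-inverse r D g₀ rD≡1) ⟩
    c zero *ₗ (r *ₗ u)         ≈⟨ *ₗ-assoc (c zero) r u ⟨
    (c zero * r) *ₗ u          ∎)

  u∈L : u ∈ ℤ-Span e
  u∈L = proj₁ (proj₂ (proj₂ denominator)) , (begin
    u                                                   ≈⟨ expansion u ⟩
    combination (λ k → coord k u) e
      ≈⟨ combination-cong {X = e} (λ k → trans (φ-* (coord-linear k) D g₀) (proj₂ (proj₂ (proj₂ denominator)) k)) (λ _ → ≈ᴹ-refl) ⟩
    combination (λ k → proj₁ (proj₂ (proj₂ denominator)) k / 1) e  ∎)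

  module ℚⁿ = LinearAlgebra (ℚ^ (suc n))

  apply-β : ∀ c i → VectorSpace.combination (ℚ^ (suc n)) c (transpose β) i ≡ sumℚ (λ j → c j * β i j)
  apply-β c i = ℚⁿ.φ-combination
    (record { φ-cong = λ v≈w → v≈w i ; φ-+ = λ _ _ → refl ; φ-* = λ _ _ → refl }) c (transpose β)

  kernel = ℚⁿ.relation-of-corank-one (transpose β) rank

  open Quadratic V B bilinear
  open Lorentzian signature
  open IsotropicLine u (scale-≉0 D≢0 g₀≉0) (isotropic u∈ℓ)
  open KernelVector β (proj₁ kernel) (proj₁ (proj₂ kernel))
    (λ c βc≡0 → proj₂ (proj₂ (proj₂ kernel)) c (λ i → trans (apply-β c i) (βc≡0 i)))
    (λ i → trans (sym (apply-β (proj₁ kernel) i)) (proj₁ (proj₂ (proj₂ kernel)) i))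
    ℓ u∈ℓ ℓ⊆ℚu
  open Enumeration e-basis L L≐ u∈L h
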